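{- Let $4\mid n$, $n\ge 8$, and let $G=\mathrm P\mathcal G_n$, identified with the amalgamated free product $S_4\ast_{D_4}D_n$. Suppose $G$ acts on a tree $X$ without terminal vertices, possibly with inversions, with finite stabilizers, such that the quotient $X/G$ is finite. Then there exists a vertex of $X$ fixed by the factor subgroup $S_4$ that has valence $3$.
   Context: $\mathcal G_n=\langle H,T_n\rangle\subseteq\mathrm U_2({\mathbf Z}[\zeta_n,1/2])$, with $\zeta_n=e^{2\pi i/n}$, $H=\frac12\begin{pmatrix}1+i&1+i\\1+i&-1-i\end{pmatrix}$, $T_n=\mathrm{diag}(1,\zeta_n)$, and $\mathrm P\mathcal G_n$ is its image modulo scalars. By a result of Radin and Sadun, $\mathrm P\mathcal G_n\cong S_4\ast_{D_4}D_n$ (symmetric group of order $24$ amalgamated with a dihedral group $D_n$ over a common dihedral subgroup $D_4$ of order $8$); such an isomorphism is fixed, and $S_4$ denotes the corresponding factor subgroup of $G$. -}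

module Defs where

open import Level using (0ℓ)
open import Data.Nat using (ℕ; zero; suc; _+_; _*_; _∸_; NonZero; _/_)
open import Data.Nat.DivMod using (_mod_)
open import Data.Fin using (Fin; toℕ; zero; suc)
open import Data.Fin.Permutation using (Permutation′; permutation; _⟨$⟩ʳ_; _∘ₚ_)
  renaming (_≈_ to _≈ₚ_)
open import Data.Bool using (Bool; true; false; _xor_; if_then_else_)
open import Data.Product using (Σ; _×_; _,_)
open import Data.Sum using (_⊎_)
open import Data.Unit using (⊤)
open import Data.List using (List)
open import Data.List.Relation.Unary.Any using (Any)
open import Relation.Binary.PropositionalEquality using (_≡_; _≢_; refl)
open import Relation.Nullary using (¬_)
open import Algebra.Bundles using (Group)
open import Algebra.Morphism.Structures using (IsGroupHomomorphism)

module _ (n : ℕ) .{{_ : NonZero n}} where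

  addMod : Fin n → Fin n → Fin n
  addMod a b = (toℕ a + toℕ b) mod n

  negMod : Fin n → Fin n
  negMod a = (n ∸ toℕ a) mod n

-- The dihedral group D_n of order 2n (symmetries of the regular n-gon
-- with vertices ℤ/n).  The element (a , e) is the symmetry
--   x ↦ a + x   (e = false, a rotation)
--   x ↦ a - x   (e = true,  a reflection)
-- and the product is composition of maps ((g · h)(x) = g (h x)).

Dih : ℕ → Set
Dih n = Fin n × Bool

module _ (n : ℕ) .{{_ : NonZero n}} where

  dihAct : Dih n → Fin n → Fin n
  dihAct (a , e) x = addMod n a (if e then negMod n x else x)

  dihMul : Dih n → Dih n → Dih n
  dihMul (a , e) (b , f) = (addMod n a (if e then negMod n b else b) , e xor f)

  dihInv : Dih n → Dih n
  dihInv (a , false) = (negMod n a , false)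
  dihInv (a , true) = (a , true)

-- The symmetric group S_4 = permutations of Fin 4, with product
-- σ ·ₛ τ = "σ after τ" (so (σ ·ₛ τ)(x) = σ (τ x)) and equality _≈ₚ_
-- (pointwise equality of permutations).

S4 : Set
S4 = Permutation′ 4

_·ₛ_ : S4 → S4 → S4
σ ·ₛ τ = τ ∘ₚ σ

d4-invˡ : ∀ (d : Dih 4) (x : Fin 4) → dihAct 4 d (dihAct 4 (dihInv 4 d) x) ≡ x
d4-invˡ (zero , false) zero = refl
d4-invˡ (zero , false) (suc zero) = refl
d4-invˡ (zero , false) (suc (suc zero)) = refl
d4-invˡ (zero , false) (suc (suc (suc zero))) = refl
d4-invˡ (zero , true) zero = refl
d4-invˡ (zero , true) (suc zero) = refl
d4-invˡ (zero , true) (suc (suc zero)) = refl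
d4-invˡ (zero , true) (suc (suc (suc zero))) = refl
d4-invˡ ((suc zero) , false) zero = refl
d4-invˡ ((suc zero) , false) (suc zero) = refl
d4-invˡ ((suc zero) , false) (suc (suc zero)) = refl
d4-invˡ ((suc zero) , false) (suc (suc (suc zero))) = refl
d4-invˡ ((suc zero) , true) zero = refl
d4-invˡ ((suc zero) , true) (suc zero) = refl
d4-invˡ ((suc zero) , true) (suc (suc zero)) = refl
d4-invˡ ((suc zero) , true) (suc (suc (suc zero))) = refl
d4-invˡ ((suc (suc zero)) , false) zero = refl
d4-invˡ ((suc (suc zero)) , false) (suc zero) = refl
d4-invˡ ((suc (suc zero)) , false) (suc (suc zero)) = refl
d4-invˡ ((suc (suc zero)) , false) (suc (suc (suc zero))) = refl
d4-invˡ ((suc (suc zero)) , true) zero = refl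
d4-invˡ ((suc (suc zero)) , true) (suc zero) = refl
d4-invˡ ((suc (suc zero)) , true) (suc (suc zero)) = refl
d4-invˡ ((suc (suc zero)) , true) (suc (suc (suc zero))) = refl
d4-invˡ ((suc (suc (suc zero))) , false) zero = refl
d4-invˡ ((suc (suc (suc zero))) , false) (suc zero) = refl
d4-invˡ ((suc (suc (suc zero))) , false) (suc (suc zero)) = refl
d4-invˡ ((suc (suc (suc zero))) , false) (suc (suc (suc zero))) = refl
d4-invˡ ((suc (suc (suc zero))) , true) zero = refl
d4-invˡ ((suc (suc (suc zero))) , true) (suc zero) = refl
d4-invˡ ((suc (suc (suc zero))) , true) (suc (suc zero)) = refl
d4-invˡ ((suc (suc (suc zero))) , true) (suc (suc (suc zero))) = refl
d4-invʳ : ∀ (d : Dih 4) (x : Fin 4) → dihAct 4 (dihInv 4 d) (dihAct 4 d x) ≡ x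
d4-invʳ (zero , false) zero = refl
d4-invʳ (zero , false) (suc zero) = refl
d4-invʳ (zero , false) (suc (suc zero)) = refl
d4-invʳ (zero , false) (suc (suc (suc zero))) = refl
d4-invʳ (zero , true) zero = refl
d4-invʳ (zero , true) (suc zero) = refl
d4-invʳ (zero , true) (suc (suc zero)) = refl
d4-invʳ (zero , true) (suc (suc (suc zero))) = refl
d4-invʳ ((suc zero) , false) zero = refl
d4-invʳ ((suc zero) , false) (suc zero) = refl
d4-invʳ ((suc zero) , false) (suc (suc zero)) = refl
d4-invʳ ((suc zero) , false) (suc (suc (suc zero))) = refl
d4-invʳ ((suc zero) , true) zero = refl
d4-invʳ ((suc zero) , true) (suc zero) = refl
d4-invʳ ((suc zero) , true) (suc (suc zero)) = refl
d4-invʳ ((suc zero) , true) (suc (suc (suc zero))) = refl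
d4-invʳ ((suc (suc zero)) , false) zero = refl
d4-invʳ ((suc (suc zero)) , false) (suc zero) = refl
d4-invʳ ((suc (suc zero)) , false) (suc (suc zero)) = refl
d4-invʳ ((suc (suc zero)) , false) (suc (suc (suc zero))) = refl
d4-invʳ ((suc (suc zero)) , true) zero = refl
d4-invʳ ((suc (suc zero)) , true) (suc zero) = refl
d4-invʳ ((suc (suc zero)) , true) (suc (suc zero)) = refl
d4-invʳ ((suc (suc zero)) , true) (suc (suc (suc zero))) = refl
d4-invʳ ((suc (suc (suc zero))) , false) zero = refl
d4-invʳ ((suc (suc (suc zero))) , false) (suc zero) = refl
d4-invʳ ((suc (suc (suc zero))) , false) (suc (suc zero)) = refl
d4-invʳ ((suc (suc (suc zero))) , false) (suc (suc (suc zero))) = refl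
d4-invʳ ((suc (suc (suc zero))) , true) zero = refl
d4-invʳ ((suc (suc (suc zero))) , true) (suc zero) = refl
d4-invʳ ((suc (suc (suc zero))) , true) (suc (suc zero)) = refl
d4-invʳ ((suc (suc (suc zero))) , true) (suc (suc (suc zero))) = refl
δ : Dih 4 → S4
δ d = permutation (dihAct 4 d) (dihAct 4 (dihInv 4 d)) (d4-invˡ d) (d4-invʳ d)

-- Embedding ι : D_4 → D_n (4 ∣ n): the symmetries of the n-gon preserving
-- the inscribed square {0, n/4, 2n/4, 3n/4}; rotation by k ↦ rotation by k·n/4.

ι : (n : ℕ) .{{_ : NonZero n}} → Dih 4 → Dih n
ι n (k , e) = ((toℕ k * (n / 4)) mod n , e)

module _ (n : ℕ) .{{_ : NonZero n}} where

  record IsS4Hom (K : Group 0ℓ 0ℓ) (f : S4 → Group.Carrier K) : Set where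
    open Group K
    field
      resp : ∀ σ τ → σ ≈ₚ τ → f σ ≈ f τ
      mult : ∀ σ τ → f (σ ·ₛ τ) ≈ f σ ∙ f τ

  record IsDihHom (K : Group 0ℓ 0ℓ) (g : Dih n → Group.Carrier K) : Set where
    open Group K
    field
      mult : ∀ x y → g (dihMul n x y) ≈ g x ∙ g y

  record IsAmalgam (G : Group 0ℓ 0ℓ)
                   (i : S4 → Group.Carrier G)
                   (j : Dih n → Group.Carrier G) : Set₁ where
    open Group G
    field
      i-hom : IsS4Hom G i
      j-hom : IsDihHom G j
      agree : ∀ d → i (δ d) ≈ j (ι n d)
      universal :
        (K : Group 0ℓ 0ℓ) (f : S4 → Group.Carrier K) (g : Dih n → Group.Carrier K) →
        IsS4Hom K f → IsDihHom K g →
        (∀ d → Group._≈_ K (f (δ d)) (g (ι n d))) →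
        Σ (Carrier → Group.Carrier K) λ h →
          IsGroupHomomorphism (Group.rawGroup G) (Group.rawGroup K) h ×
          (∀ σ → Group._≈_ K (h (i σ)) (f σ)) ×
          (∀ x → Group._≈_ K (h (j x)) (g x)) ×
          ((h′ : Carrier → Group.Carrier K) →
            IsGroupHomomorphism (Group.rawGroup G) (Group.rawGroup K) h′ →
            (∀ σ → Group._≈_ K (h′ (i σ)) (f σ)) →
            (∀ x → Group._≈_ K (h′ (j x)) (g x)) →
            ∀ z → Group._≈_ K (h′ z) (h z))

-- Graphs in the sense of Serre: vertices, oriented edges, origin map,
-- fixed-point-free involution e ↦ ē; terminus t e = o ē.

record Graph : Set₁ where
  field
    V : Set
    E : Set
    o : E → V
    rev : E → E
    rev-invol : ∀ e → rev (rev e) ≡ e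
    rev-nofix : ∀ e → rev e ≢ e

  t : E → V
  t e = o (rev e)

  data Path : V → V → Set where
    [] : ∀ {v} → Path v v
    step : ∀ {u w} (e : E) → o e ≡ u → Path (t e) w → Path u w

  length : ∀ {u w} → Path u w → ℕ
  length [] = 0
  length (step _ _ p) = suc (length p)

  NoBacktrack : ∀ {u w} → E → Path u w → Set
  NoBacktrack e [] = ⊤
  NoBacktrack e (step e′ _ _) = e′ ≢ rev e

  Reduced : ∀ {u w} → Path u w → Set
  Reduced [] = ⊤
  Reduced (step e _ p) = NoBacktrack e p × Reduced p

  IsTree : Set
  IsTree = V ×
           (∀ u w → Path u w) ×
           (∀ v (p : Path v v) → Reduced p → length p ≡ 0)

  Terminal : V → Set
  Terminal v = Σ E λ e → o e ≡ v × (∀ e′ → o e′ ≡ v → e′ ≡ e)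

  Valence3 : V → Set
  Valence3 v =
    Σ E λ e₀ → Σ E λ e₁ → Σ E λ e₂ →
      o e₀ ≡ v × o e₁ ≡ v × o e₂ ≡ v ×
      e₀ ≢ e₁ × e₀ ≢ e₂ × e₁ ≢ e₂ ×
      (∀ e → o e ≡ v → e ≡ e₀ ⊎ e ≡ e₁ ⊎ e ≡ e₂)

-- Left action of a group on a graph by graph automorphisms
-- (inversions, i.e. g ē = e for some edge e, are allowed).

record Action (G : Group 0ℓ 0ℓ) (X : Graph) : Set where
  open Group G
  open Graph X
  field
    actV : Carrier → V → V
    actE : Carrier → E → E
    respV : ∀ {g h} v → g ≈ h → actV g v ≡ actV h v
    respE : ∀ {g h} e → g ≈ h → actE g e ≡ actE h e
    identV : ∀ v → actV ε v ≡ v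
    identE : ∀ e → actE ε e ≡ e
    compV : ∀ g h v → actV (g ∙ h) v ≡ actV g (actV h v)
    compE : ∀ g h e → actE (g ∙ h) e ≡ actE g (actE h e)
    o-equiv : ∀ g e → o (actE g e) ≡ actV g (o e)
    rev-equiv : ∀ g e → rev (actE g e) ≡ actE g (rev e)

  FiniteStabilizers : Set
  FiniteStabilizers =
    ∀ v → Σ (List Carrier) λ L → ∀ g → actV g v ≡ v → Any (g ≈_) L

  FiniteQuotient : Set
  FiniteQuotient =
    (Σ (List V) λ L → ∀ v → Any (λ w → Σ Carrier λ g → actV g w ≡ v) L) ×
    (Σ (List E) λ L → ∀ e → Any (λ f → Σ Carrier λ g → actE g f ≡ e) L)

{-# OPTIONS --safe #-}

-- A finite group acting on a tree moves a vertex v only in one direction: if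
-- v lay strictly between two points of its orbit, the orbit would be unbounded.
-- Following these directions, S₄ ends at a fixed vertex or at an inverted edge;
-- in the second case D_n preserves that edge too, so G would be finite.
-- Let v₀ be fixed by S₄.  No d in D_n outside D₄ fixes v₀, again because G is
-- infinite, and all these d move v₀ in the direction of one edge e₁, which D₄
-- therefore fixes.  If S₄ fixed e₁ we could move v₀ along e₁ towards d v₀, so
-- for a suitable v₀ the orbit of e₁ under S₄ consists of three edges.  Writing
-- g in normal form, the geodesic from v₀ to g v₀ starts with one of these.
-- A fourth edge at v₀ would lead into a part of X that avoids the orbit of v₀:
-- it has bounded depth by cocompactness, but no dead ends.
--
-- Constructively, equality in G is decidable by normal forms, and cocompactness
-- transfers this to vertices and edges of X.
module Submission where

open import Defs
open import Level using (0ℓ)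
open import Data.Nat using (ℕ; zero; suc; _+_; _*_; _∸_; _/_; _%_; NonZero; _≤_; _<_; z≤n; s≤s; s≤s⁻¹)
open import Data.Nat.Properties as ℕ using (≤-trans; ≤-refl; ≤-reflexive; m≤m+n; m≤n+m; m+[n∸m]≡n; n<1+n)
open import Data.Nat.Divisibility using (_∣_; divides)
open import Data.Nat.DivMod using (_mod_; m<n⇒m%n≡m; %-distribˡ-+; [m+n]%n≡m%n; m*n/n≡m; m≡m%n+[m/n]*n; [m+kn]%n≡m%n)
open import Data.Nat.ListAction using (sum)
open import Data.Fin as Fin using (Fin; toℕ; suc; combine; remQuot)
open import Data.Fin.Patterns using (0F; 1F; 2F; 3F)
open import Data.Fin.Permutation as Perm using (_⟨$⟩ʳ_; _∘ₚ_; transpose) renaming (_≈_ to _≈ₚ_; id to idₚ; flip to flipₚ)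
open import Data.Fin.Properties as Fin using (toℕ-fromℕ<; toℕ<n; toℕ≤n; toℕ-combine; combine-remQuot; remQuot-combine; pigeonhole)
open import Data.Bool as Bool using (Bool; true; false; _xor_)
open import Data.List using (List; []; _∷_; _++_; length; lookup; map; allFin; cartesianProduct)
open import Data.List.Properties using (length-map; length-++; ∷-injectiveˡ)
open import Data.List.Membership.Propositional using (_∈_)
open import Data.List.Membership.Propositional.Properties using (∈-allFin; ∈-cartesianProduct⁺; ∈-map⁺)
import Data.List.Relation.Unary.All as All
open import Data.List.Relation.Unary.Any as Any using (Any; here; there)
open import Data.List.Relation.Unary.Any.Properties as Any using (lookup-index)
open import Data.Product using (Σ; ∃; _×_; _,_; proj₁; proj₂; uncurry)
open import Data.Product.Properties using (≡-dec)
open import Data.Sum using (_⊎_; inj₁; inj₂; [_,_]′)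
open import Data.Unit using (⊤; tt)
open import Data.Empty using (⊥; ⊥-elim)
open import Relation.Binary.Bundles using (Setoid)
open import Relation.Binary.Definitions using (DecidableEquality)
open import Relation.Binary.PropositionalEquality using (_≡_; _≢_; refl; sym; trans; cong; cong₂; subst; subst₂; isEquivalence; module ≡-Reasoning)
open import Relation.Nullary using (¬_; Dec; yes; no; contradiction)
open import Relation.Nullary.Decidable using (map′; _×-dec_; _⊎-dec_; _→-dec_; ¬?; decidable-stable; toWitness)
open import Relation.Unary using (Decidable)
open import Algebra.Bundles using (Group; AbelianGroup)
open import Algebra.Morphism.Structures using (IsGroupHomomorphism)
import Algebra.Morphism.Construct.Identity as Identity
import Algebra.Properties.AbelianGroup as AbelianGroupProperties
import Algebra.Properties.Group as GroupProperties
import Relation.Binary.Reasoning.Setoid as SetoidReasoning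


-- Bounds over finite lists and unbounded functions

Any-≤-sum : ∀ {A : Set} {P : A → Set} (f : A → ℕ) {h} {xs} →
            (∀ {x} → P x → h ≤ f x) → Any P xs → h ≤ sum (map f xs)
Any-≤-sum f le (here px) = ≤-trans (le px) (m≤m+n _ _)
Any-≤-sum f le (there a) = ≤-trans (Any-≤-sum f le a) (m≤n+m _ _)

unbounded : {A : Set} (f : A → ℕ) → (∀ x → Σ A λ y → f x < f y) →
            ∀ N → A → ¬ (∀ x → f x ≤ N)
unbounded {A} f grow N x₀ f≤N = ℕ.<⇒≱ (proj₂ (large (suc N))) (f≤N _)
  where
  large : ∀ k → Σ A λ x → k ≤ f x
  large zero = x₀ , z≤n
  large (suc k) with x , k≤fx ← large k with y , fx<fy ← grow x = y , ≤-trans (s≤s k≤fx) fx<fy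

-- Geodesics in a tree

module Geodesics (X : Graph)
                 (paths : ∀ u w → Graph.Path X u w)
                 (acyclic : ∀ v (p : Graph.Path X v v) → Graph.Reduced X p → Graph.length X p ≡ 0)
                 (_≟_ : DecidableEquality (Graph.E X)) where

  open Graph X using (V; E; o; rev; t; rev-invol; Path; []; step; Reduced; NoBacktrack)

  t-rev : ∀ e → t (rev e) ≡ o e
  t-rev e = cong o (rev-invol e)

  -- A path is a bare list of edges, with its endpoints kept in a predicate. Geodesics are then
  -- compared by equality of lists, without the proofs of `o e ≡ u` that `Path` stores in each step.
  Chain : V → List E → V → Set
  Chain u [] w = u ≡ w
  Chain u (e ∷ p) w = o e ≡ u × Chain (t e) p w

  -- For lists that leave a common vertex: running back along one and out along the other does not
  -- backtrack there. `Apart (rev e ∷ []) p` is the condition that `e ∷ p` does not backtrack at its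
  -- first step.
  Apart : List E → List E → Set
  Apart [] q = ⊤
  Apart (e ∷ p) [] = ⊤
  Apart (e ∷ p) (f ∷ q) = e ≢ f

  Apart-[] : ∀ p → Apart p []
  Apart-[] [] = tt
  Apart-[] (_ ∷ _) = tt

  Apart-either : ∀ {e f} → e ≢ f → ∀ p q r → Apart (e ∷ p) r ⊎ Apart (f ∷ q) r
  Apart-either e≢f p q [] = inj₁ tt
  Apart-either {e} e≢f p q (h ∷ r) with e ≟ h
  ... | yes refl = inj₂ λ f≡e → e≢f (sym f≡e)
  ... | no e≢h = inj₁ e≢h

  Red : List E → Set
  Red [] = ⊤
  Red (e ∷ p) = Apart (rev e ∷ []) p × Red p

  Geo : V → List E → V → Set
  Geo u p w = Chain u p w × Red p

  -- The path that runs backwards along `p` and then along `q`, for `p` and `q` with a common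
  -- origin.
  revOnto : List E → List E → List E
  revOnto [] q = q
  revOnto (e ∷ p) q = revOnto p (rev e ∷ q)

  length-revOnto : ∀ p q → length (revOnto p q) ≡ length p + length q
  length-revOnto [] q = refl
  length-revOnto (e ∷ p) q = trans (length-revOnto p (rev e ∷ q)) (ℕ.+-suc (length p) (length q))

  revOnto-++ : ∀ p q r → revOnto p (q ++ r) ≡ revOnto p q ++ r
  revOnto-++ [] q r = refl
  revOnto-++ (e ∷ p) q r = revOnto-++ p (rev e ∷ q) r

  revOnto-snoc : ∀ p e q → revOnto (p ++ e ∷ []) q ≡ rev e ∷ revOnto p q
  revOnto-snoc [] e q = refl
  revOnto-snoc (f ∷ p) e q = revOnto-snoc p e (rev f ∷ q)

  Chain-revOnto : ∀ {c a b} p q → Chain c p a → Chain c q b → Chain a (revOnto p q) b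
  Chain-revOnto [] q refl q-chain = q-chain
  Chain-revOnto (e ∷ p) q (refl , p-chain) q-chain =
    Chain-revOnto p (rev e ∷ q) p-chain (refl , subst (λ v → Chain v q _) (sym (t-rev e)) q-chain)

  Red-revOnto : ∀ p q → Red p → Red q → Apart p q → Red (revOnto p q)
  Red-revOnto [] q _ q-red _ = q-red
  Red-revOnto (e ∷ p) q (e-p , p-red) q-red ap =
    Red-revOnto p (rev e ∷ q) p-red (rev-apart q ap , q-red) (flip-apart p e-p)
    where
    rev-apart : ∀ q → Apart (e ∷ p) q → Apart (rev (rev e) ∷ []) q
    rev-apart [] _ = tt
    rev-apart (f ∷ q) e≢f = λ eq → e≢f (trans (sym (rev-invol e)) eq)
    flip-apart : ∀ p → Apart (rev e ∷ []) p → Apart p (rev e ∷ q)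
    flip-apart [] _ = tt
    flip-apart (_ ∷ _) ne = λ eq → ne (sym eq)

  through : ∀ {c a b} p q → Geo c p a → Geo c q b → Apart p q → Geo a (revOnto p q) b
  through p q (pc , pr) (qc , qr) ap = Chain-revOnto p q pc qc , Red-revOnto p q pr qr ap

  Geo-sym : ∀ {a b} p → Geo a p b → Geo b (revOnto p []) a
  Geo-sym p γ = through p [] γ (refl , tt) (Apart-[] p)

  Geo-tail : ∀ {u e p w} → Geo u (e ∷ p) w → Geo (t e) p w
  Geo-tail ((_ , c) , (_ , r)) = c , r

  Geo-edge : ∀ e → Geo (o e) (e ∷ []) (t e)
  Geo-edge e = (refl , refl) , (tt , tt)

  Geo-closed : ∀ {v} p → Geo v p v → p ≡ []
  Geo-closed [] _ = refl
  Geo-closed {v} (e ∷ p) (c , r) =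
    contradiction (acyclic v (toPath (e ∷ p) c) (toPath-reduced (e ∷ p) c r)) λ ()
    where
    toPath : ∀ {u w} p → Chain u p w → Path u w
    toPath [] refl = []
    toPath (e ∷ p) (eq , c) = step e eq (toPath p c)
    toPath-noBacktrack : ∀ {u w} e p (c : Chain u p w) → Apart (rev e ∷ []) p → NoBacktrack e (toPath p c)
    toPath-noBacktrack e [] refl _ = tt
    toPath-noBacktrack e (f ∷ p) (eq , c) ne = λ f≡ → ne (sym f≡)
    toPath-reduced : ∀ {u w} p (c : Chain u p w) → Red p → Reduced (toPath p c)
    toPath-reduced [] refl _ = tt
    toPath-reduced (e ∷ p) (eq , c) (a , r) = toPath-noBacktrack e p c a , toPath-reduced p c r

  ¬Geo-closed : ∀ {v e p} → ¬ Geo v (e ∷ p) v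
  ¬Geo-closed γ = contradiction (Geo-closed _ γ) λ ()

  -- Equal first edges are stripped. Where the two lists first differ, running back along one and
  -- out along the other would be a nonempty closed geodesic.
  Geo-unique : ∀ {u w} p q → Geo u p w → Geo u q w → p ≡ q
  Geo-unique [] [] _ _ = refl
  Geo-unique [] (f ∷ q) (refl , _) γ = contradiction γ ¬Geo-closed
  Geo-unique (e ∷ p) [] γ (refl , _) = contradiction γ ¬Geo-closed
  Geo-unique (e ∷ p) (f ∷ q) γ γ′ with e ≟ f
  ... | yes refl = cong (e ∷_) (Geo-unique p q (Geo-tail γ) (Geo-tail γ′))
  ... | no e≢f = contradiction
    (trans (sym (length-revOnto (e ∷ p) (f ∷ q)))
           (cong length (Geo-closed (revOnto (e ∷ p) (f ∷ q)) (through (e ∷ p) (f ∷ q) γ γ′ e≢f)))) λ ()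

  first-unique : ∀ {u w e p f q} → Geo u (e ∷ p) w → Geo u (f ∷ q) w → e ≡ f
  first-unique γ γ′ = ∷-injectiveˡ (Geo-unique _ _ γ γ′)

  reduce : ∀ {u w} → Path u w → Σ (List E) λ p → Geo u p w
  reduce [] = [] , refl , tt
  reduce (step e eq path) with reduce path
  ... | [] , γ = e ∷ [] , (eq , proj₁ γ) , (tt , tt)
  ... | f ∷ q , γ with rev e ≟ f
  ...   | yes refl = q , subst (λ v → Geo v q _) (trans (t-rev e) eq) (Geo-tail γ)
  ...   | no ne = e ∷ f ∷ q , (eq , proj₁ γ) , (ne , proj₂ γ)

  opaque
    geodesic : ∀ u w → Σ (List E) λ p → Geo u p w
    geodesic u w = reduce (paths u w)

    first : ∀ {u w} → u ≢ w → Σ E λ e → Σ (List E) λ p → Geo u (e ∷ p) w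
    first {u} {w} u≢w with geodesic u w
    ... | [] , γ = contradiction (proj₁ γ) u≢w
    ... | e ∷ p , γ = e , p , γ

  dist : V → V → ℕ
  dist u w = length (proj₁ (geodesic u w))

  dist-Geo : ∀ {u p w} → Geo u p w → dist u w ≡ length p
  dist-Geo γ = cong length (Geo-unique _ _ (proj₂ (geodesic _ _)) γ)

  dist-sym-Geo : ∀ {u w} p → Geo u p w → dist w u ≡ length p
  dist-sym-Geo p γ = trans (dist-Geo (Geo-sym p γ)) (trans (length-revOnto p []) (ℕ.+-identityʳ _))

-- Translates of geodesics under the action

module Equivariance {G : Group 0ℓ 0ℓ} {X : Graph} (A : Action G X)
                    (paths : ∀ u w → Graph.Path X u w)
                    (acyclic : ∀ v (p : Graph.Path X v v) → Graph.Reduced X p → Graph.length X p ≡ 0)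
                    (_≟E_ : DecidableEquality (Graph.E X)) where

  open Group G using (Carrier; _≈_; _∙_; ε; _⁻¹; inverseˡ)
  open Graph X using (V; E; o; rev; t)
  open Action A
  open Geodesics X paths acyclic _≟E_

  t-equiv : ∀ g e → t (actE g e) ≡ actV g (t e)
  t-equiv g e = trans (cong o (rev-equiv g e)) (o-equiv g (rev e))

  act-inverseV : ∀ {g h} → g ∙ h ≈ ε → ∀ v → actV g (actV h v) ≡ v
  act-inverseV eq v = trans (sym (compV _ _ v)) (trans (respV v eq) (identV v))

  act-inverseE : ∀ {g h} → g ∙ h ≈ ε → ∀ e → actE g (actE h e) ≡ e
  act-inverseE eq e = trans (sym (compE _ _ e)) (trans (respE e eq) (identE e))

  actE-injective : ∀ g {e f} → actE g e ≡ actE g f → e ≡ f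
  actE-injective g {e} {f} eq = trans (sym (act-inverseE (inverseˡ g) e))
    (trans (cong (actE (g ⁻¹)) eq) (act-inverseE (inverseˡ g) f))

  actV-injective : ∀ g {u v} → actV g u ≡ actV g v → u ≡ v
  actV-injective g {u} {v} eq = trans (sym (act-inverseV (inverseˡ g) u))
    (trans (cong (actV (g ⁻¹)) eq) (act-inverseV (inverseˡ g) v))

  Chain-act : ∀ g {u w} p → Chain u p w → Chain (actV g u) (map (actE g) p) (actV g w)
  Chain-act g [] eq = cong (actV g) eq
  Chain-act g (e ∷ p) (eq , c) = trans (o-equiv g e) (cong (actV g) eq) ,
    subst (λ v → Chain v (map (actE g) p) _) (sym (t-equiv g e)) (Chain-act g p c)

  Red-act : ∀ g p → Red p → Red (map (actE g) p)
  Red-act g [] _ = tt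
  Red-act g (e ∷ p) (a , r) = apart p a , Red-act g p r
    where
    apart : ∀ p → Apart (rev e ∷ []) p → Apart (rev (actE g e) ∷ []) (map (actE g) p)
    apart [] _ = tt
    apart (f ∷ p) ne = λ eq → ne (actE-injective g (trans (sym (rev-equiv g e)) eq))

  Geo-act : ∀ g {u p w} → Geo u p w → Geo (actV g u) (map (actE g) p) (actV g w)
  Geo-act g (c , r) = Chain-act g _ c , Red-act g _ r

  fixes-t : ∀ {g e} → actE g e ≡ e → actV g (t e) ≡ t e
  fixes-t {g} {e} eq = trans (sym (t-equiv g e)) (cong t eq)

  -- Finite groups acting on a tree

  module FiniteGroup
    (_≟V_ : DecidableEquality V)
    {I : Set} (φ : I → Carrier) (_·_ : I → I → I) (inv : I → I)
    (φ-· : ∀ x y → φ (x · y) ≈ φ x ∙ φ y) (φ-inv : ∀ x → φ x ∙ φ (inv x) ≈ ε)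
    -- Completeness is stated through `φ`, since permutations carry only pointwise equality. The
    -- module is applied to S₄ via `i` and to D_n via `j`.
    (elements : List I) (complete : ∀ x → Any (λ y → φ x ≈ φ y) elements) where

    infixr 8 _▹_ _▸_
    _▹_ : I → V → V
    x ▹ v = actV (φ x) v
    _▸_ : I → E → E
    x ▸ e = actE (φ x) e

    ▹-· : ∀ x y v → (x · y) ▹ v ≡ x ▹ y ▹ v
    ▹-· x y v = trans (respV v (φ-· x y)) (compV _ _ v)

    opaque
      search : {Q : Carrier → Set} → (∀ g → Dec (Q g)) → (∀ {g h} → g ≈ h → Q g → Q h) →
               (Σ I λ x → Q (φ x)) ⊎ (∀ x → ¬ Q (φ x))
      search Q? resp with Any.any? (λ x → Q? (φ x)) elements
      ... | yes found = inj₁ (Any.satisfied found)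
      ... | no none = inj₂ λ x qx → none (Any.map (λ eq → resp eq qx) (complete x))

      displacement-bound : ∀ v → Σ ℕ λ N → ∀ x → dist (x ▹ v) v ≤ N
      displacement-bound v = sum (map (λ x → dist (x ▹ v) v) elements) , λ x →
        Any-≤-sum _ (λ eq → ≤-reflexive (cong (λ u → dist u v) (respV v eq))) (complete x)

    opaque
      -- If v lay strictly between two points of its orbit, so would every
      -- point of the orbit, and the orbit could be left in some direction
      -- away from v at each of its points, so it would be unbounded.
      same-direction : ∀ {v} x y {e p f q} →
        Geo v (e ∷ p) (x ▹ v) → Geo v (f ∷ q) (y ▹ v) → e ≡ f
      same-direction {v} x y {e} {p} {f} {q} γ γ′ = decidable-stable (e ≟E f) λ e≢f →
        unbounded (λ z → dist (z ▹ v) v) (grow e≢f) _ x (proj₂ (displacement-bound v))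
        where
        extend : ∀ z w {r h s} → Geo (z ▹ v) r v → Geo v (h ∷ s) (w ▹ v) →
                 Apart (z ▸ h ∷ map (z ▸_) s) r → length r < dist ((z · w) ▹ v) v
        extend z w {r} {h} {s} ρ σ ap = subst (length r <_)
          (sym (trans (cong (λ u → dist u v) (▹-· z w v))
            (trans (dist-Geo (through (z ▸ h ∷ map (z ▸_) s) r (Geo-act (φ z) σ) ρ ap))
                   (length-revOnto (z ▸ h ∷ map (z ▸_) s) r))))
          (s≤s (m≤n+m (length r) _))
        grow : e ≢ f → ∀ z → Σ I λ w → dist (z ▹ v) v < dist (w ▹ v) v
        grow e≢f z with geodesic (z ▹ v) v
        ... | r , ρ with Apart-either {z ▸ e} {z ▸ f} (λ eq → e≢f (actE-injective (φ z) eq))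
                           (map (z ▸_) p) (map (z ▸_) q) r
        ...   | inj₁ ap = z · x , extend z x ρ γ ap
        ...   | inj₂ ap = z · y , extend z y ρ γ′ ap

    opaque
      -- `y` carries the geodesic from `v` to `x ▹ v` to one from `v` to `(y · x) ▹ v`, and both
      -- leave `v` along the same edge.
      stabilizer-fixes-direction : ∀ {v} x y {e p} → y ▹ v ≡ v → Geo v (e ∷ p) (x ▹ v) → y ▸ e ≡ e
      stabilizer-fixes-direction {v} x y {e} {p} fix γ = same-direction (y · x) x
        (subst₂ (λ a b → Geo a (y ▸ e ∷ map (y ▸_) p) b) fix (sym (▹-· y x v)) (Geo-act (φ y) γ)) γ

    opaque
      -- `inv y` also moves `v` in the direction `e`; translating that geodesic by `y` gives the one
      -- back from `y ▹ v` to `v`.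
      return : ∀ {v} y {e p} → Geo v (e ∷ p) (y ▹ v) → Σ (List E) λ q → Geo (y ▹ v) (y ▸ e ∷ q) v
      return {v} y {e} {p} γ with first {v} {inv y ▹ v} moved
        where
        moved : v ≢ inv y ▹ v
        moved eq = ¬Geo-closed (subst (Geo v (e ∷ p)) (trans (cong (y ▹_) eq) (act-inverseV (φ-inv y) v)) γ)
      ... | f , q , γ′ with refl ← same-direction y (inv y) γ γ′ =
        map (y ▸_) q , subst (Geo (y ▹ v) _) (act-inverseV (φ-inv y) v) (Geo-act (φ y) γ′)

    opaque
      -- By `return` the geodesic from `v` to `y ▹ v` begins with `e` and ends with the reverse of
      -- `y ▸ e`. If these are the same step, `y` inverts `e`; otherwise dropping both leaves the
      -- geodesic from `t e` to `y ▹ t e`.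
      shrink : ∀ {v} y {e p} → Geo v (e ∷ p) (y ▹ v) →
               y ▸ e ≡ rev e ⊎ dist (y ▹ t e) (t e) < length p
      shrink y {e} {[]} γ = inj₁ (first-unique (proj₂ (return y γ)) (Geo-sym (e ∷ []) γ))
      -- The way back is written twice: ending in `rev e`, and beginning with `y ▸ e`. `shorten`
      -- removes both ends.
      shrink {v} y {e} {f ∷ p} γ = inj₂ (shorten (revOnto (f ∷ p) []) back-length
          (Geo-sym (f ∷ p) (Geo-tail γ)) (trans (sym (revOnto-++ (f ∷ p) [] (rev e ∷ [])))
          (Geo-unique _ _ (Geo-sym (e ∷ f ∷ p) γ) (proj₂ (return y γ)))))
        where
        back-length : length (revOnto (f ∷ p) []) ≡ length (f ∷ p)
        back-length = trans (length-revOnto (f ∷ p) []) (ℕ.+-identityʳ _)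
        shorten : ∀ r → length r ≡ length (f ∷ p) → Geo (y ▹ v) r (t e) →
                  ∀ {q} → r ++ rev e ∷ [] ≡ y ▸ e ∷ q → dist (y ▹ t e) (t e) < length (f ∷ p)
        shorten (h ∷ r) len ρ eq = subst₂ _<_ (sym (dist-Geo shorter)) len ≤-refl
          where
          shorter : Geo (y ▹ t e) r (t e)
          shorter = subst (λ u → Geo u r (t e))
            (trans (cong t (∷-injectiveˡ eq)) (t-equiv (φ y) e)) (Geo-tail ρ)

    opaque
      -- Descent on a bound `N` for the displacement of `v`: if `v` is moved in the direction `e`
      -- and no group element inverts `e`, then `t e` has a smaller bound.
      fixed-or-inverts : V → (Σ V λ u → ∀ x → x ▹ u ≡ u) ⊎ (Σ E λ e → Σ I λ x → x ▸ e ≡ rev e)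
      fixed-or-inverts v₀ = descend _ v₀ (proj₂ (displacement-bound v₀))
        where
        descend : ∀ N v → (∀ x → dist (x ▹ v) v ≤ N) →
                  (Σ V λ u → ∀ x → x ▹ u ≡ u) ⊎ (Σ E λ e → Σ I λ x → x ▸ e ≡ rev e)
        descend N v ≤N with search (λ g → ¬? (v ≟V actV g v)) (λ eq ne eq′ → ne (trans eq′ (sym (respV v eq))))
        ... | inj₂ none = inj₁ (v , λ x → sym (decidable-stable (v ≟V _) (none x)))
        ... | inj₁ (x , moved) with first moved
        ... | e , p , γ with search (λ g → actE g e ≟E rev e) (λ eq inv → trans (sym (respE e eq)) inv)
        ... | inj₁ (y , inverts) = inj₂ (e , y , inverts)
        descend zero v ≤N | inj₁ (x , moved) | e , p , γ | inj₂ none =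
          contradiction (subst (_≤ 0) (dist-sym-Geo (e ∷ p) γ) (≤N x)) λ ()
        descend (suc N) v ≤N | inj₁ (x , moved) | e , p , γ | inj₂ none = descend N (t e) bound
          where
          bound : ∀ y → dist (y ▹ t e) (t e) ≤ N
          -- An element that fixes `v` fixes `e`, hence `t e`. Any other element moves `v` in the
          -- same direction `e`, so `shrink` applies to it.
          bound y with v ≟V (y ▹ v)
          ... | yes eq = subst (_≤ N) (sym (dist-Geo {p = []}
            (fixes-t (stabilizer-fixes-direction x y (sym eq) γ) , tt))) z≤n
          ... | no moved′ with first moved′
          ...   | f , q , γ′ with refl ← same-direction x y γ γ′ with shrink y γ′
          ...     | inj₁ inverts = contradiction inverts (none y)
          ...     | inj₂ lt = ≤-trans (ℕ.<⇒≤ lt)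
            (s≤s⁻¹ (subst (_≤ suc N) (dist-sym-Geo (e ∷ q) γ′) (≤N y)))

    opaque
      inverted-Geo : ∀ {e} x → x ▸ e ≡ rev e → Geo (o e) (e ∷ []) (x ▹ o e)
      inverted-Geo {e} x inverts =
        subst (Geo _ _) (trans (cong o (sym inverts)) (o-equiv (φ x) e)) (Geo-edge e)

    opaque
      -- An element fixing `o e` fixes the direction `e`. Any other one moves `o e` along `e`, and
      -- it moves it no further than `t e`, as `adjacent` shows.
      inverted-edge-preserved : ∀ {e} x → x ▸ e ≡ rev e → ∀ y → y ▸ e ≡ e ⊎ y ▸ e ≡ rev e
      inverted-edge-preserved {e} x inverts y with o e ≟V (y ▹ o e)
      ... | yes eq = inj₁ (stabilizer-fixes-direction x y (sym eq) (inverted-Geo x inverts))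
      ... | no moved with first moved
      ...   | f , p , γ = inj₂ (adjacent p (subst (λ h → Geo (o e) (h ∷ p) (y ▹ o e))
                                  (same-direction y x γ (inverted-Geo x inverts)) γ))
        where
        adjacent : ∀ p → Geo (o e) (e ∷ p) (y ▹ o e) → y ▸ e ≡ rev e
        adjacent [] γ = first-unique (proj₂ (return y γ)) (Geo-sym (e ∷ []) γ)
        -- `inv x` carries `t e` to `o e`, so it turns the rest of the geodesic into one from `o e`
        -- to another orbit point. That one starts with `e`, whence `h` is `x ▸ e`, that is `rev e`:
        -- a backtrack.
        adjacent (h ∷ q) γ = contradiction
          (trans (sym inverts) (trans (cong (x ▸_) e≡) (act-inverseE (φ-inv x) h)))
          (proj₁ (proj₂ γ))
          where
          pulled-back : Geo (o e) (inv x ▸ h ∷ map (inv x ▸_) q) ((inv x · y) ▹ o e)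
          pulled-back = subst₂ (λ a b → Geo a (inv x ▸ h ∷ map (inv x ▸_) q) b)
            (actV-injective (φ x) (trans (act-inverseV (φ-inv x) (t e))
                                         (proj₂ (proj₁ (inverted-Geo x inverts)))))
            (sym (▹-· (inv x) y (o e))) (Geo-act (φ (inv x)) (Geo-tail γ))
          e≡ : e ≡ inv x ▸ h
          e≡ = same-direction x (inv x · y) (inverted-Geo x inverts) pulled-back

-- Integers modulo n and the dihedral group laws

module _ (n : ℕ) .{{_ : NonZero n}} where

  toℕ-mod : ∀ a → toℕ (a mod n) ≡ a % n
  toℕ-mod a = toℕ-fromℕ< _

  mod-cong : ∀ {a b} → a % n ≡ b % n → a mod n ≡ b mod n
  mod-cong {a} {b} eq = Fin.toℕ-injective (trans (toℕ-mod a) (trans eq (sym (toℕ-mod b))))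

  mod-toℕ : ∀ x → toℕ x mod n ≡ x
  mod-toℕ x = Fin.toℕ-injective (trans (toℕ-mod _) (m<n⇒m%n≡m (toℕ<n x)))

  addMod-mod : ∀ a b → addMod n (a mod n) (b mod n) ≡ (a + b) mod n
  addMod-mod a b = mod-cong (trans (cong₂ (λ x y → (x + y) % n) (toℕ-mod a) (toℕ-mod b))
                                   (sym (%-distribˡ-+ a b n)))

  addMod-assoc : ∀ x y z → addMod n (addMod n x y) z ≡ addMod n x (addMod n y z)
  addMod-assoc x y z = begin
    addMod n (addMod n x y) z                        ≡⟨ cong (addMod n _) (mod-toℕ z) ⟨
    addMod n (addMod n x y) (toℕ z mod n)            ≡⟨ addMod-mod _ _ ⟩
    (toℕ x + toℕ y + toℕ z) mod n                    ≡⟨ cong (_mod n) (ℕ.+-assoc (toℕ x) _ _) ⟩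
    (toℕ x + (toℕ y + toℕ z)) mod n                  ≡⟨ addMod-mod _ _ ⟨
    addMod n (toℕ x mod n) (addMod n y z)            ≡⟨ cong (λ w → addMod n w _) (mod-toℕ x) ⟩
    addMod n x (addMod n y z)                        ∎
    where open ≡-Reasoning

  addMod-comm : ∀ x y → addMod n x y ≡ addMod n y x
  addMod-comm x y = cong (_mod n) (ℕ.+-comm (toℕ x) (toℕ y))

  addMod-identityˡ : ∀ x → addMod n (0 mod n) x ≡ x
  addMod-identityˡ x = trans (cong (addMod n _) (sym (mod-toℕ x))) (trans (addMod-mod 0 _) (mod-toℕ x))

  addMod-inverseʳ : ∀ x → addMod n x (negMod n x) ≡ 0 mod n
  addMod-inverseʳ x = begin
    addMod n x (negMod n x)                          ≡⟨ cong (λ w → addMod n w (negMod n x)) (mod-toℕ x) ⟨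
    addMod n (toℕ x mod n) ((n ∸ toℕ x) mod n)       ≡⟨ addMod-mod _ _ ⟩
    (toℕ x + (n ∸ toℕ x)) mod n                      ≡⟨ cong (_mod n) (m+[n∸m]≡n (toℕ≤n x)) ⟩
    n mod n                                          ≡⟨ mod-cong ([m+n]%n≡m%n 0 n) ⟩
    0 mod n                                          ∎
    where open ≡-Reasoning

  ℤ/ : AbelianGroup 0ℓ 0ℓ
  ℤ/ = record
    { Carrier = Fin n ; _≈_ = _≡_ ; _∙_ = addMod n ; ε = 0 mod n ; _⁻¹ = negMod n
    ; isAbelianGroup = record
      { isGroup = record
        { isMonoid = record
          { isSemigroup = record
            { isMagma = record { isEquivalence = isEquivalence ; ∙-cong = cong₂ (addMod n) }
            ; assoc = addMod-assoc }
          ; identity = addMod-identityˡ , λ x → trans (addMod-comm x _) (addMod-identityˡ x) }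
        ; inverse = (λ x → trans (addMod-comm _ x) (addMod-inverseʳ x)) , addMod-inverseʳ
        ; ⁻¹-cong = cong (negMod n) }
      ; comm = addMod-comm } }

  open AbelianGroup ℤ/ using (identityˡ; identityʳ; inverseˡ; inverseʳ; assoc)
  open AbelianGroupProperties ℤ/ using (⁻¹-∙-comm; ⁻¹-involutive; ε⁻¹≈ε)

  dih1 : Dih n
  dih1 = 0 mod n , false

  dihMul-assoc : ∀ x y z → dihMul n (dihMul n x y) z ≡ dihMul n x (dihMul n y z)
  dihMul-assoc (a , false) (b , false) (c , g) = cong (_, g) (assoc a b c)
  dihMul-assoc (a , false) (b , true) (c , g) = cong (_, _) (assoc a b (negMod n c))
  dihMul-assoc (a , true) (b , false) (c , g) = cong (_, _)
    (trans (assoc a (negMod n b) (negMod n c)) (cong (addMod n a) (⁻¹-∙-comm b c)))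
  dihMul-assoc (a , true) (b , true) (c , g) = cong₂ _,_
    (trans (assoc a (negMod n b) c) (cong (addMod n a)
      (trans (cong (addMod n _) (sym (⁻¹-involutive c))) (⁻¹-∙-comm b (negMod n c)))))
    (sym (not² g))
    where
    not² : ∀ g → Bool.not (Bool.not g) ≡ g
    not² false = refl
    not² true = refl

  dihMul-identityˡ : ∀ x → dihMul n dih1 x ≡ x
  dihMul-identityˡ (a , e) = cong (_, e) (identityˡ a)

  dihMul-identityʳ : ∀ x → dihMul n x dih1 ≡ x
  dihMul-identityʳ (a , false) = cong (_, false) (identityʳ a)
  dihMul-identityʳ (a , true) = cong (_, true) (trans (cong (addMod n a) ε⁻¹≈ε) (identityʳ a))

  dihMul-inverseʳ : ∀ x → dihMul n x (dihInv n x) ≡ dih1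
  dihMul-inverseʳ (a , false) = cong (_, false) (inverseʳ a)
  dihMul-inverseʳ (a , true) = cong (_, false) (inverseʳ a)

  dihMul-inverseˡ : ∀ x → dihMul n (dihInv n x) x ≡ dih1
  dihMul-inverseˡ (a , false) = cong (_, false) (inverseˡ a)
  dihMul-inverseˡ (a , true) = cong (_, false) (inverseʳ a)

  -- `dihAct n x k` is by definition the first component of `dihMul n x (k , false)`, so this is
  -- associativity.
  dihAct-dihMul : ∀ x y k → dihAct n (dihMul n x y) k ≡ dihAct n x (dihAct n y k)
  dihAct-dihMul x y k = cong proj₁ (dihMul-assoc x y (k , false))

  dihElements : List (Dih n)
  dihElements = cartesianProduct (allFin n) (true ∷ false ∷ [])

  ∈-dihElements : ∀ x → x ∈ dihElements
  ∈-dihElements (k , true) = ∈-cartesianProduct⁺ (∈-allFin k) (here refl)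
  ∈-dihElements (k , false) = ∈-cartesianProduct⁺ (∈-allFin k) (there (here refl))

-- Coset representatives of D₄ in D_n

module DihedralCosets (m : ℕ) .{{_ : NonZero (4 * m)}} where

  private
    n = 4 * m
    module ℤ/n where
      open AbelianGroupProperties (ℤ/ n) public using (⁻¹-∙-comm; ⁻¹-involutive; inverseˡ-unique)

  -- The rotation part of `ι`, with `n / 4` evaluated to `m`.
  quarter : Fin 4 → Fin n
  quarter k = (toℕ k * m) mod n

  ι≡quarter : ∀ k e → ι n (k , e) ≡ (quarter k , e)
  ι≡quarter k e = cong (λ q → (toℕ k * q) mod n , e)
    (trans (cong (_/ 4) (ℕ.*-comm 4 m)) (m*n/n≡m m 4))

  quarter-add : ∀ k l → quarter (addMod 4 k l) ≡ addMod n (quarter k) (quarter l)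
  quarter-add k l = sym (begin
    addMod n (quarter k) (quarter l)  ≡⟨ addMod-mod n _ _ ⟩
    (toℕ k * m + toℕ l * m) mod n     ≡⟨ cong (_mod n) (ℕ.*-distribʳ-+ m (toℕ k) _) ⟨
    (s * m) mod n                     ≡⟨ cong (λ x → (x * m) mod n) (m≡m%n+[m/n]*n s 4) ⟩
    ((s % 4 + s / 4 * 4) * m) mod n   ≡⟨ cong (_mod n) (ℕ.*-distribʳ-+ m (s % 4) _) ⟩
    (s % 4 * m + s / 4 * 4 * m) mod n ≡⟨ cong (λ x → (s % 4 * m + x) mod n) (ℕ.*-assoc (s / 4) 4 m) ⟩
    (s % 4 * m + s / 4 * n) mod n     ≡⟨ mod-cong n ([m+kn]%n≡m%n (s % 4 * m) (s / 4) n) ⟩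
    (s % 4 * m) mod n                 ≡⟨ cong (λ x → (x * m) mod n) (toℕ-mod 4 s) ⟨
    quarter (addMod 4 k l)            ∎)
    where
    open ≡-Reasoning
    s = toℕ k + toℕ l

  quarter-neg : ∀ k → quarter (negMod 4 k) ≡ negMod n (quarter k)
  quarter-neg k = ℤ/n.inverseˡ-unique _ _
    (trans (sym (quarter-add (negMod 4 k) k)) (cong quarter (AbelianGroup.inverseˡ (ℤ/ 4) k)))

  ι-mul : ∀ c d → ι n (dihMul 4 c d) ≡ dihMul n (ι n c) (ι n d)
  ι-mul (k , false) (l , f) = trans (ι≡quarter (addMod 4 k l) f) (trans (cong (_, f) (quarter-add k l))
    (sym (cong₂ (dihMul n) (ι≡quarter k false) (ι≡quarter l f))))
  ι-mul (k , true) (l , f) = trans (ι≡quarter (addMod 4 k (negMod 4 l)) (true xor f))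
    (trans (cong (_, true xor f) (trans (quarter-add k (negMod 4 l)) (cong (addMod n (quarter k)) (quarter-neg l))))
    (sym (cong₂ (dihMul n) (ι≡quarter k true) (ι≡quarter l f))))

  rotation : Fin m → Dih n
  rotation a = toℕ a mod n , false

  quarter+rotation : ∀ c a → addMod n (quarter c) (toℕ a mod n) ≡ combine {4} {m} c a
  quarter+rotation c a = begin
    addMod n (quarter c) (toℕ a mod n)  ≡⟨ addMod-mod n _ _ ⟩
    (toℕ c * m + toℕ a) mod n           ≡⟨ cong (λ x → (x + toℕ a) mod n) (ℕ.*-comm (toℕ c) m) ⟩
    (m * toℕ c + toℕ a) mod n           ≡⟨ cong (_mod n) (toℕ-combine {4} {m} c a) ⟨
    toℕ (combine {4} {m} c a) mod n     ≡⟨ mod-toℕ n _ ⟩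
    combine {4} {m} c a                 ∎
    where open ≡-Reasoning

  opaque
    -- The rotations by less than `m` represent the cosets of D₄, with D₄ on the left; a code is the
    -- D₄ part together with the representative.
    dihVal : Dih 4 × Fin m → Dih n
    dihVal (d , a) = dihMul n (ι n d) (rotation a)

    dihVal-ι : ∀ d a → dihVal (d , a) ≡ dihMul n (ι n d) (rotation a)
    dihVal-ι d a = refl

    dihVal-1 : ∀ a → dihVal (dih1 4 , a) ≡ rotation a
    dihVal-1 a = trans (cong (λ x → dihMul n x (rotation a)) (ι≡quarter (proj₁ (dih1 4)) false))
      (dihMul-identityˡ n (rotation a))

    -- (k , true) is the reflection x ↦ -x followed by the rotation by k, that is
    -- the rotation by -k followed by x ↦ -x.
    dihCode : Dih n → Dih 4 × Fin m
    dihCode (k , false) = (proj₁ (remQuot m k) , false) , proj₂ (remQuot {4} m k)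
    dihCode (k , true) = (negMod 4 (proj₁ (remQuot m (negMod n k))) , true) , proj₂ (remQuot {4} m (negMod n k))

    dihVal-false : ∀ c a → dihVal ((c , false) , a) ≡ (combine {4} {m} c a , false)
    dihVal-false c a = trans (cong (λ x → dihMul n x (rotation a)) (ι≡quarter c false))
      (cong (_, false) (quarter+rotation c a))

    dihVal-true : ∀ c a → dihVal ((negMod 4 c , true) , a) ≡ (negMod n (combine {4} {m} c a) , true)
    dihVal-true c a = trans
      (cong (λ x → dihMul n x (rotation a)) (trans (ι≡quarter (negMod 4 c) true) (cong (_, true) (quarter-neg c))))
      (cong (_, true) (trans (ℤ/n.⁻¹-∙-comm (quarter c) (toℕ a mod n)) (cong (negMod n) (quarter+rotation c a))))

    dihVal-dihCode : ∀ x → dihVal (dihCode x) ≡ x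
    dihVal-dihCode (k , false) = trans (uncurry dihVal-false (remQuot {4} m k)) (cong (_, false) (combine-remQuot {4} m k))
    dihVal-dihCode (k , true) = trans (uncurry dihVal-true (remQuot {4} m (negMod n k)))
      (cong (_, true) (trans (cong (negMod n) (combine-remQuot {4} m (negMod n k))) (ℤ/n.⁻¹-involutive k)))

    dihCode-dihVal : ∀ c → dihCode (dihVal c) ≡ c
    dihCode-dihVal ((k , false) , a) = trans (cong dihCode (dihVal-false k a))
      (cong (λ (c , a) → (c , false) , a) (remQuot-combine {4} {m} k a))
    dihCode-dihVal ((k , true) , a) = begin
      dihCode (dihVal ((k , true) , a))                       ≡⟨ cong (λ l → dihCode (dihVal ((l , true) , a))) k≡ ⟩
      dihCode (dihVal ((negMod 4 k′ , true) , a))             ≡⟨ cong dihCode (dihVal-true k′ a) ⟩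
      dihCode (negMod n (combine {4} {m} k′ a) , true)        ≡⟨ cong reflectionCode (trans
        (cong (remQuot m) (ℤ/n.⁻¹-involutive _)) (remQuot-combine {4} {m} k′ a)) ⟩
      ((negMod 4 k′ , true) , a)                              ≡⟨ cong (λ l → (l , true) , a) k≡ ⟨
      ((k , true) , a)                                        ∎
      where
      open ≡-Reasoning
      k′ : Fin 4
      k′ = negMod 4 k
      k≡ : k ≡ negMod 4 k′
      k≡ = sym (AbelianGroupProperties.⁻¹-involutive (ℤ/ 4) k)
      reflectionCode : Fin 4 × Fin m → Dih 4 × Fin m
      reflectionCode (c , a) = (negMod 4 c , true) , a

-- Exhaustive search and coset representatives of D₄ in S₄

module _ {A : Set} (xs : List A) (complete : ∀ x → x ∈ xs) {P : A → Set} (P? : Decidable P) where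

  listAll? : Dec (∀ x → P x)
  listAll? = map′ (λ ps x → All.lookup ps (complete x)) (λ ps → All.tabulate λ {x} _ → ps x) (All.all? P? xs)

  listAny? : Dec (∃ P)
  listAny? = map′ Any.satisfied (λ (x , px) → Any.map (λ eq → subst P eq px) (complete x)) (Any.any? P? xs)

δ-mul : ∀ c d → δ (dihMul 4 c d) ≈ₚ δ c ·ₛ δ d
δ-mul c d = dihAct-dihMul 4 c d

-- A 3-cycle and its powers. They form a complement to the subgroup D₄ of index 3, so they represent
-- its cosets on either side.
cyc : Fin 3 → S4
cyc 0F = idₚ
cyc 1F = transpose 0F 1F ∘ₚ transpose 1F 2F
cyc 2F = flipₚ (cyc 1F)

S4Code : Set
S4Code = Dih 4 × Fin 3

_≟C_ : DecidableEquality S4Code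
_≟C_ = ≡-dec (≡-dec Fin._≟_ Bool._≟_) Fin._≟_

s4Val : S4Code → S4
s4Val (d , k) = δ d ·ₛ cyc k

s4Codes : List S4Code
s4Codes = cartesianProduct (dihElements 4) (allFin 3)

∈-s4Codes : ∀ c → c ∈ s4Codes
∈-s4Codes (d , k) = ∈-cartesianProduct⁺ (∈-dihElements 4 d) (∈-allFin k)

_≈ₚ?_ : (σ τ : S4) → Dec (σ ≈ₚ τ)
σ ≈ₚ? τ = Fin.all? λ x → (σ ⟨$⟩ʳ x) Fin.≟ (τ ⟨$⟩ʳ x)

Values : (a b c d : Fin 4) → S4 → Set
Values a b c d σ = σ ⟨$⟩ʳ 0F ≡ a × σ ⟨$⟩ʳ 1F ≡ b × σ ⟨$⟩ʳ 2F ≡ c × σ ⟨$⟩ʳ 3F ≡ d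

opaque
  -- Permutations contain functions, so the search runs over the 256 quadruples of possible values
  -- instead.
  s4Val-table : ∀ a b c d →
    (a ≡ b ⊎ a ≡ c ⊎ a ≡ d ⊎ b ≡ c ⊎ b ≡ d ⊎ c ≡ d) ⊎ ∃ λ x → Values a b c d (s4Val x)
  s4Val-table = toWitness {a? = Fin.all? λ a → Fin.all? λ b → Fin.all? λ c → Fin.all? λ d →
    (a Fin.≟ b ⊎-dec a Fin.≟ c ⊎-dec a Fin.≟ d ⊎-dec b Fin.≟ c ⊎-dec b Fin.≟ d ⊎-dec c Fin.≟ d) ⊎-dec
    listAny? s4Codes ∈-s4Codes λ x → (s4Val x ⟨$⟩ʳ 0F Fin.≟ a) ×-dec (s4Val x ⟨$⟩ʳ 1F Fin.≟ b) ×-dec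
      (s4Val x ⟨$⟩ʳ 2F Fin.≟ c) ×-dec (s4Val x ⟨$⟩ʳ 3F Fin.≟ d)} tt

opaque
  s4Val-injective : ∀ c d → s4Val c ≈ₚ s4Val d → c ≡ d
  s4Val-injective = toWitness {a? = listAll? s4Codes ∈-s4Codes λ c → listAll? s4Codes ∈-s4Codes λ d →
    (s4Val c ≈ₚ? s4Val d) →-dec (c ≟C d)} tt

opaque
  -- The codes have D₄ on the left; for the action on an edge fixed by D₄ it has to stand on the
  -- right.
  s4Val-left-coset : ∀ c → ∃ λ ((d , k) : S4Code) → s4Val c ≈ₚ cyc k ·ₛ δ d
  s4Val-left-coset = toWitness {a? = listAll? s4Codes ∈-s4Codes λ c → listAny? s4Codes ∈-s4Codes λ (d , k) →
    s4Val c ≈ₚ? (cyc k ·ₛ δ d)} tt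

opaque
  cyc-square : cyc 2F ≈ₚ cyc 1F ·ₛ cyc 1F
  cyc-square = toWitness {a? = cyc 2F ≈ₚ? (cyc 1F ·ₛ cyc 1F)} tt

  cyc-cube : cyc 1F ·ₛ cyc 2F ≈ₚ idₚ
  cyc-cube = toWitness {a? = (cyc 1F ·ₛ cyc 2F) ≈ₚ? idₚ} tt

opaque
  s4-code : ∀ σ → ∃ λ c → s4Val c ≈ₚ σ
  s4-code σ with s4Val-table (σ ⟨$⟩ʳ 0F) (σ ⟨$⟩ʳ 1F) (σ ⟨$⟩ʳ 2F) (σ ⟨$⟩ʳ 3F)
  ... | inj₂ (c , v₀ , v₁ , v₂ , v₃) = c , λ { 0F → v₀ ; 1F → v₁ ; 2F → v₂ ; 3F → v₃ }
  ... | inj₁ coincidence = contradiction coincidence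
    λ { (inj₁ eq) → distinct (λ ()) eq
      ; (inj₂ (inj₁ eq)) → distinct (λ ()) eq
      ; (inj₂ (inj₂ (inj₁ eq))) → distinct (λ ()) eq
      ; (inj₂ (inj₂ (inj₂ (inj₁ eq)))) → distinct (λ ()) eq
      ; (inj₂ (inj₂ (inj₂ (inj₂ (inj₁ eq))))) → distinct (λ ()) eq
      ; (inj₂ (inj₂ (inj₂ (inj₂ (inj₂ eq))))) → distinct (λ ()) eq }
    where
    distinct : ∀ {x y} → x ≢ y → σ ⟨$⟩ʳ x ≢ σ ⟨$⟩ʳ y
    distinct x≢y eq = x≢y (trans (sym (Perm.inverseˡ σ)) (trans (cong (σ Perm.⟨$⟩ˡ_) eq) (Perm.inverseˡ σ)))

s4Code : S4 → S4Code
s4Code σ = proj₁ (s4-code σ)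

s4Val-s4Code : ∀ σ → s4Val (s4Code σ) ≈ₚ σ
s4Val-s4Code σ = proj₂ (s4-code σ)

s4Code-unique : ∀ {σ c} → σ ≈ₚ s4Val c → s4Code σ ≡ c
s4Code-unique {σ} {c} eq = s4Val-injective _ c λ x → trans (s4Val-s4Code σ x) (eq x)

-- Infinite families, and normal forms in the amalgam

module _ (S : Setoid 0ℓ 0ℓ) where
  open Setoid S using (Carrier; _≈_; reflexive) renaming (sym to ≈-sym; trans to ≈-trans)

  injective⇒infinite : (f : ℕ → Carrier) → (∀ r s → f r ≈ f s → r ≡ s) →
                       ∀ (L : List Carrier) → ¬ (∀ r → Any (f r ≈_) L)
  injective⇒infinite f f-injective L cover
    with x , y , x<y , same ← pigeonhole (n<1+n (length L)) (λ x → Any.index (cover (toℕ x))) =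
    Fin.<⇒≢ x<y (Fin.toℕ-injective (f-injective _ _ (≈-trans (lookup-index (cover (toℕ x)))
      (≈-trans (reflexive (cong (lookup L) same)) (≈-sym (lookup-index (cover (toℕ y))))))))

-- Every element of the amalgam is uniquely c ∙ l with c in S₄ and l an
-- alternating product of the nontrivial coset representatives that does not
-- start in S₄, and also c ∙ l with c in D_n and l not starting in D_n.
module NormalForms (m₁ : ℕ)
  {G : Group 0ℓ 0ℓ} {i : S4 → Group.Carrier G} {j : Dih (4 * suc m₁) → Group.Carrier G}
  (amalgam : IsAmalgam (4 * suc m₁) G i j) where

  private
    m n : ℕ
    m = suc m₁
    n = 4 * m

  open Group G hiding (isEquivalence) renaming (refl to ≈-refl; sym to ≈-sym; trans to ≈-trans)
  open GroupProperties G using (identityʳ-unique; ∙-cancelˡ)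
  open IsAmalgam amalgam
  open DihedralCosets m
  module i = IsS4Hom i-hom
  module j = IsDihHom j-hom

  -- A letter `a` of `Fin m₁` stands for `rotation (suc a)` and a letter `k` of `Fin 2` for
  -- `cyc (suc k)`; index 0, the trivial representative, never occurs.
  data SFree : Set
  data DFree : Set

  data SFree where
    []  : SFree
    _∷_ : Fin m₁ → DFree → SFree

  data DFree where
    []  : DFree
    _∷_ : Fin 2 → SFree → DFree

  -- Two coordinate systems for the same words: S₄ multiplies only the head in `Ω`, D_n only the
  -- head in `Ω′`. Passing from one to the other keeps the D₄ part and moves a representative
  -- between head and tail.
  Ω Ω′ : Set
  Ω = S4Code × SFree
  Ω′ = (Dih 4 × Fin m) × DFree

  toΩ′ : Ω → Ω′
  toΩ′ ((d , 0F) , []) = (d , 0F) , []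
  toΩ′ ((d , 0F) , (a ∷ l)) = (d , suc a) , l
  toΩ′ ((d , suc k) , l) = (d , 0F) , (k ∷ l)

  fromΩ′ : Ω′ → Ω
  fromΩ′ ((d , 0F) , []) = (d , 0F) , []
  fromΩ′ ((d , 0F) , (k ∷ l)) = (d , suc k) , l
  fromΩ′ ((d , suc a) , l) = (d , 0F) , (a ∷ l)

  fromΩ′-toΩ′ : ∀ ω → fromΩ′ (toΩ′ ω) ≡ ω
  fromΩ′-toΩ′ ((d , 0F) , []) = refl
  fromΩ′-toΩ′ ((d , 0F) , (a ∷ l)) = refl
  fromΩ′-toΩ′ ((d , suc k) , l) = refl

  toΩ′-fromΩ′ : ∀ ω → toΩ′ (fromΩ′ ω) ≡ ω
  toΩ′-fromΩ′ ((d , 0F) , []) = refl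
  toΩ′-fromΩ′ ((d , 0F) , (k ∷ l)) = refl
  toΩ′-fromΩ′ ((d , suc a) , l) = refl

  infix 4 _≟S_ _≟D_
  _≟S_ : DecidableEquality SFree
  _≟D_ : DecidableEquality DFree
  [] ≟S [] = yes refl
  [] ≟S (_ ∷ _) = no λ ()
  (_ ∷ _) ≟S [] = no λ ()
  (a ∷ l) ≟S (b ∷ r) = map′ (uncurry (cong₂ _∷_)) (λ { refl → refl , refl }) (a Fin.≟ b ×-dec l ≟D r)
  [] ≟D [] = yes refl
  [] ≟D (_ ∷ _) = no λ ()
  (_ ∷ _) ≟D [] = no λ ()
  (a ∷ l) ≟D (b ∷ r) = map′ (uncurry (cong₂ _∷_)) (λ { refl → refl , refl }) (a Fin.≟ b ×-dec l ≟S r)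

  _≟Ω_ : DecidableEquality Ω
  _≟Ω_ = ≡-dec _≟C_ _≟S_

  actS : S4 → Ω → Ω
  actS σ (c , l) = s4Code (σ ·ₛ s4Val c) , l

  actS-resp : ∀ {σ τ} → σ ≈ₚ τ → ∀ ω → actS σ ω ≡ actS τ ω
  actS-resp {σ} {τ} eq (c , l) = cong (_, l) (s4Code-unique {σ ·ₛ s4Val c} λ x →
    trans (eq _) (sym (s4Val-s4Code (τ ·ₛ s4Val c) x)))

  actS-· : ∀ σ τ ω → actS (σ ·ₛ τ) ω ≡ actS σ (actS τ ω)
  actS-· σ τ (c , l) = cong (_, l) (s4Code-unique {(σ ·ₛ τ) ·ₛ s4Val c} λ x →
    sym (trans (s4Val-s4Code (σ ·ₛ s4Val (s4Code (τ ·ₛ s4Val c))) x)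
                   (cong (σ ⟨$⟩ʳ_) (s4Val-s4Code (τ ·ₛ s4Val c) x))))

  actS-id : ∀ ω → actS idₚ ω ≡ ω
  actS-id (c , l) = cong (_, l) (s4Code-unique {idₚ ·ₛ s4Val c} λ x → refl)

  actD′ : Dih n → Ω′ → Ω′
  actD′ x (c , l) = dihCode (dihMul n x (dihVal c)) , l

  actD : Dih n → Ω → Ω
  actD x ω = fromΩ′ (actD′ x (toΩ′ ω))

  actD-fromΩ′ : ∀ x ω → actD x (fromΩ′ ω) ≡ fromΩ′ (actD′ x ω)
  actD-fromΩ′ x ω = cong (λ ω → fromΩ′ (actD′ x ω)) (toΩ′-fromΩ′ ω)

  actD-· : ∀ x y ω → actD (dihMul n x y) ω ≡ actD x (actD y ω)
  actD-· x y ω = sym (trans (actD-fromΩ′ x (actD′ y (toΩ′ ω)))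
    (cong (λ c → fromΩ′ (dihCode c , proj₂ (toΩ′ ω))) (trans
      (cong (dihMul n x) (dihVal-dihCode (dihMul n y (dihVal (proj₁ (toΩ′ ω))))))
      (sym (dihMul-assoc n x y (dihVal (proj₁ (toΩ′ ω))))))))

  actD-1 : ∀ ω → actD (dih1 n) ω ≡ ω
  actD-1 ω = trans (cong (λ c → fromΩ′ (c , proj₂ (toΩ′ ω))) (trans
    (cong dihCode (dihMul-identityˡ n (dihVal (proj₁ (toΩ′ ω))))) (dihCode-dihVal (proj₁ (toΩ′ ω)))))
    (fromΩ′-toΩ′ ω)

  actS-δ : ∀ d c k l → actS (δ d) ((c , k) , l) ≡ ((dihMul 4 d c , k) , l)
  actS-δ d c k l = cong (_, l) (s4Code-unique {δ d ·ₛ s4Val (c , k)} λ x → sym (δ-mul d c (cyc k ⟨$⟩ʳ x)))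

  actD′-ι : ∀ d c a l → actD′ (ι n d) ((c , a) , l) ≡ ((dihMul 4 d c , a) , l)
  actD′-ι d c a l = cong (_, l) (trans (cong dihCode dihMul-ι-dihVal) (dihCode-dihVal (dihMul 4 d c , a)))
    where
    open ≡-Reasoning
    dihMul-ι-dihVal : dihMul n (ι n d) (dihVal (c , a)) ≡ dihVal (dihMul 4 d c , a)
    dihMul-ι-dihVal = begin
      dihMul n (ι n d) (dihVal (c , a))                    ≡⟨ cong (dihMul n (ι n d)) (dihVal-ι c a) ⟩
      dihMul n (ι n d) (dihMul n (ι n c) (rotation a))     ≡⟨ dihMul-assoc n (ι n d) (ι n c) (rotation a) ⟨
      dihMul n (dihMul n (ι n d) (ι n c)) (rotation a)     ≡⟨ cong (λ x → dihMul n x (rotation a)) (ι-mul d c) ⟨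
      dihMul n (ι n (dihMul 4 d c)) (rotation a)           ≡⟨ dihVal-ι (dihMul 4 d c) a ⟨
      dihVal (dihMul 4 d c , a)                            ∎

  -- In both coordinate systems D₄ multiplies only the D₄ part, which the conversion keeps. The
  -- universal property asks for this compatibility.
  actS-δ≡actD-ι : ∀ d ω → actS (δ d) ω ≡ actD (ι n d) ω
  actS-δ≡actD-ι d ((c , 0F) , []) = trans (actS-δ d c 0F []) (sym (cong fromΩ′ (actD′-ι d c 0F [])))
  actS-δ≡actD-ι d ((c , 0F) , (a ∷ l)) =
    trans (actS-δ d c 0F (a ∷ l)) (sym (cong fromΩ′ (actD′-ι d c (suc a) l)))
  actS-δ≡actD-ι d ((c , suc k) , l) =
    trans (actS-δ d c (suc k) l) (sym (cong fromΩ′ (actD′-ι d c 0F (k ∷ l))))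

  evalS : SFree → Carrier
  evalD : DFree → Carrier
  evalS [] = ε
  evalS (a ∷ l) = j (rotation (suc a)) ∙ evalD l
  evalD [] = ε
  evalD (k ∷ l) = i (cyc (suc k)) ∙ evalS l

  eval : Ω → Carrier
  eval (c , l) = i (s4Val c) ∙ evalS l

  eval′ : Ω′ → Carrier
  eval′ (c , l) = j (dihVal c) ∙ evalD l

  i-id : i idₚ ≈ ε
  i-id = identityʳ-unique _ _ (≈-trans (≈-sym (i.mult idₚ idₚ)) (i.resp _ _ λ _ → refl))

  j-1 : j (dih1 n) ≈ ε
  j-1 = identityʳ-unique _ _ (≈-trans (≈-sym (j.mult _ _)) (reflexive (cong j (dihMul-identityˡ n (dih1 n)))))

  i-flip : ∀ σ → i σ ∙ i (flipₚ σ) ≈ ε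
  i-flip σ = ≈-trans (≈-sym (i.mult _ _)) (≈-trans (i.resp _ _ λ _ → Perm.inverseʳ σ) i-id)

  j-inv : ∀ x → j x ∙ j (dihInv n x) ≈ ε
  j-inv x = ≈-trans (≈-sym (j.mult _ _)) (≈-trans (reflexive (cong j (dihMul-inverseʳ n x))) j-1)

  eval′-toΩ′ : ∀ ω → eval′ (toΩ′ ω) ≈ eval ω
  eval′-toΩ′ ω = ≈-trans (split′ (toΩ′ ω)) (≈-trans (middle ω) (≈-sym (split ω)))
    where
    split : ∀ ((( d , k) , l) : Ω) → eval ((d , k) , l) ≈ i (δ d) ∙ (i (cyc k) ∙ evalS l)
    split ((d , k) , l) = ≈-trans (∙-congʳ (i.mult (δ d) (cyc k))) (assoc _ _ _)
    split′ : ∀ (((d , a) , l) : Ω′) → eval′ ((d , a) , l) ≈ i (δ d) ∙ (j (rotation a) ∙ evalD l)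
    split′ ((d , a) , l) = ≈-trans (∙-congʳ (≈-trans (reflexive (cong j (dihVal-ι d a)))
      (≈-trans (j.mult (ι n d) (rotation a)) (∙-congʳ (≈-sym (agree d)))))) (assoc _ _ _)
    middle : ∀ ω → i (δ (proj₁ (proj₁ (toΩ′ ω)))) ∙
                     (j (rotation (proj₂ (proj₁ (toΩ′ ω)))) ∙ evalD (proj₂ (toΩ′ ω)))
                 ≈ i (δ (proj₁ (proj₁ ω))) ∙ (i (cyc (proj₂ (proj₁ ω))) ∙ evalS (proj₂ ω))
    middle ((d , 0F) , []) = ∙-congˡ (∙-congʳ (≈-trans j-1 (≈-sym i-id)))
    middle ((d , 0F) , (a ∷ l)) = ∙-congˡ (≈-sym (≈-trans (∙-congʳ i-id) (identityˡ _)))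
    middle ((d , suc k) , l) = ∙-congˡ (≈-trans (∙-congʳ j-1) (identityˡ _))

  eval-actS : ∀ σ ω → eval (actS σ ω) ≈ i σ ∙ eval ω
  eval-actS σ (c , l) = ≈-trans
    (∙-congʳ (≈-trans (i.resp _ _ (s4Val-s4Code (σ ·ₛ s4Val c))) (i.mult _ _))) (assoc _ _ _)

  eval-actD : ∀ x ω → eval (actD x ω) ≈ j x ∙ eval ω
  eval-actD x ω = begin
    eval (fromΩ′ ω′)                       ≈⟨ eval′-toΩ′ (fromΩ′ ω′) ⟨
    eval′ (toΩ′ (fromΩ′ ω′))               ≡⟨ cong eval′ (toΩ′-fromΩ′ ω′) ⟩
    eval′ ω′                               ≡⟨ cong (λ y → j y ∙ evalD (proj₂ (toΩ′ ω)))
                                                (dihVal-dihCode (dihMul n x (dihVal (proj₁ (toΩ′ ω))))) ⟩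
    j (dihMul n x (dihVal (proj₁ (toΩ′ ω)))) ∙ evalD (proj₂ (toΩ′ ω))
                                           ≈⟨ ≈-trans (∙-congʳ (j.mult _ _)) (assoc _ _ _) ⟩
    j x ∙ eval′ (toΩ′ ω)                   ≈⟨ ∙-congˡ (eval′-toΩ′ ω) ⟩
    j x ∙ eval ω                           ∎
    where
    open SetoidReasoning setoid
    ω′ = actD′ x (toΩ′ ω)

  -- Keeping the element next to the permutation of normal forms makes eval
  -- equivariant under the whole of G by the universal property alone.
  record Lift : Set where
    field
      elt : Carrier
      to from : Ω → Ω
      to-from : ∀ ω → to (from ω) ≡ ω
      from-to : ∀ ω → from (to ω) ≡ ω
      eval-to : ∀ ω → eval (to ω) ≈ elt ∙ eval ω

  open Lift

  lifts : Group 0ℓ 0ℓ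
  lifts = record
    { Carrier = Lift
    ; _≈_ = λ x y → elt x ≈ elt y × (∀ ω → to x ω ≡ to y ω)
    ; _∙_ = λ x y → record
      { elt = elt x ∙ elt y
      ; to = λ ω → to x (to y ω)
      ; from = λ ω → from y (from x ω)
      ; to-from = λ ω → trans (cong (to x) (to-from y _)) (to-from x ω)
      ; from-to = λ ω → trans (cong (from y) (from-to x _)) (from-to y ω)
      ; eval-to = λ ω → ≈-trans (eval-to x _) (≈-trans (∙-congˡ (eval-to y ω)) (≈-sym (assoc _ _ _))) }
    ; ε = record
      { elt = ε ; to = λ ω → ω ; from = λ ω → ω
      ; to-from = λ _ → refl ; from-to = λ _ → refl ; eval-to = λ ω → ≈-sym (identityˡ _) }
    ; _⁻¹ = λ x → record
      { elt = elt x ⁻¹ ; to = from x ; from = to x ; to-from = from-to x ; from-to = to-from x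
      ; eval-to = λ ω → ∙-cancelˡ (elt x) _ _ (≈-trans (≈-sym (eval-to x (from x ω)))
          (≈-trans (reflexive (cong eval (to-from x ω)))
          (≈-sym (≈-trans (≈-sym (assoc _ _ _)) (≈-trans (∙-congʳ (inverseʳ _)) (identityˡ _)))))) }
    ; isGroup = record
      { isMonoid = record
        { isSemigroup = record
          { isMagma = record
            { isEquivalence = record
              { refl = ≈-refl , λ _ → refl
              ; sym = λ (p , q) → ≈-sym p , λ ω → sym (q ω)
              ; trans = λ (p , q) (p′ , q′) → ≈-trans p p′ , λ ω → trans (q ω) (q′ ω) }
            ; ∙-cong = λ {x} {_} {_} {v} (p , q) (p′ , q′) →
                ∙-cong p p′ , λ ω → trans (cong (to x) (q′ ω)) (q (to v ω)) }
          ; assoc = λ x y z → assoc _ _ _ , λ _ → refl }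
        ; identity = (λ x → identityˡ _ , λ _ → refl) , λ x → identityʳ _ , λ _ → refl }
      ; inverse = (λ x → inverseˡ _ , from-to x) , λ x → inverseʳ _ , to-from x
      ; ⁻¹-cong = λ {x} {y} (p , q) → ⁻¹-cong p , λ ω →
          trans (cong (from x) (sym (trans (q (from y ω)) (to-from y ω)))) (from-to x (from y ω)) } }

  liftS : S4 → Lift
  liftS σ = record
    { elt = i σ ; to = actS σ ; from = actS (flipₚ σ)
    ; to-from = λ ω → trans (sym (actS-· σ (flipₚ σ) ω))
        (trans (actS-resp {σ ·ₛ flipₚ σ} {idₚ} (λ _ → Perm.inverseʳ σ) ω) (actS-id ω))
    ; from-to = λ ω → trans (sym (actS-· (flipₚ σ) σ ω))
        (trans (actS-resp {flipₚ σ ·ₛ σ} {idₚ} (λ _ → Perm.inverseˡ σ) ω) (actS-id ω))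
    ; eval-to = eval-actS σ }

  liftD : Dih n → Lift
  liftD x = record
    { elt = j x ; to = actD x ; from = actD (dihInv n x)
    ; to-from = λ ω → trans (sym (actD-· x (dihInv n x) ω))
        (trans (cong (λ y → actD y ω) (dihMul-inverseʳ n x)) (actD-1 ω))
    ; from-to = λ ω → trans (sym (actD-· (dihInv n x) x ω))
        (trans (cong (λ y → actD y ω) (dihMul-inverseˡ n x)) (actD-1 ω))
    ; eval-to = eval-actD x }

  opaque
    lift : Σ (Carrier → Lift) λ h → IsGroupHomomorphism (Group.rawGroup G) (Group.rawGroup lifts) h ×
           (∀ σ → Group._≈_ lifts (h (i σ)) (liftS σ)) × (∀ x → Group._≈_ lifts (h (j x)) (liftD x))
    lift with h , hom , on-i , on-j , _ ← universal lifts liftS liftD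
           (record { resp = λ σ τ eq → i.resp σ τ eq , actS-resp {σ} {τ} eq
                   ; mult = λ σ τ → i.mult σ τ , actS-· σ τ })
           (record { mult = λ x y → j.mult x y , actD-· x y })
           (λ d → agree d , actS-δ≡actD-ι d) = h , hom , on-i , on-j

  private
    h : Carrier → Lift
    h = proj₁ lift
    module h = IsGroupHomomorphism (proj₁ (proj₂ lift))

  opaque
    -- both sides are endomorphisms of G extending i and j
    elt-h : ∀ g → elt (h g) ≈ g
    elt-h g with _ , _ , _ , _ , unique ← universal G i j i-hom j-hom agree =
      ≈-trans (unique (λ g → elt (h g)) elt∘h-hom (λ σ → proj₁ (proj₁ (proj₂ (proj₂ lift)) σ))
               (λ x → proj₁ (proj₂ (proj₂ (proj₂ lift)) x)) g)
            (≈-sym (unique (λ g → g) (Identity.isGroupHomomorphism (Group.rawGroup G) (≈-refl))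
               (λ _ → ≈-refl) (λ _ → ≈-refl) g))
      where
      elt∘h-hom : IsGroupHomomorphism (Group.rawGroup G) (Group.rawGroup G) (λ g → elt (h g))
      elt∘h-hom = record
        { isMonoidHomomorphism = record
          { isMagmaHomomorphism = record
            { isRelHomomorphism = record { cong = λ eq → proj₁ (h.⟦⟧-cong eq) }
            ; homo = λ x y → proj₁ (h.homo x y) }
          ; ε-homo = proj₁ h.ε-homo }
        ; ⁻¹-homo = λ x → proj₁ (h.⁻¹-homo x) }

  act : Carrier → Ω → Ω
  act g = to (h g)

  act-i : ∀ σ ω → act (i σ) ω ≡ actS σ ω
  act-i σ = proj₂ (proj₁ (proj₂ (proj₂ lift)) σ)

  act-j : ∀ x ω → act (j x) ω ≡ actD x ω
  act-j x = proj₂ (proj₂ (proj₂ (proj₂ lift)) x)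

  act-∙ : ∀ g g′ ω → act (g ∙ g′) ω ≡ act g (act g′ ω)
  act-∙ g g′ = proj₂ (h.homo g g′)

  ω₀ : Ω
  ω₀ = (dih1 4 , 0F) , []

  normalForm : Carrier → Ω
  normalForm g = act g ω₀

  normalForm-cong : ∀ {g g′} → g ≈ g′ → normalForm g ≡ normalForm g′
  normalForm-cong eq = proj₂ (h.⟦⟧-cong eq) ω₀

  -- Equivariance of `eval` at `ω₀`, which evaluates to `ε`. It makes equality in `G` decidable.
  eval-normalForm : ∀ g → eval (normalForm g) ≈ g
  eval-normalForm g = ≈-trans (eval-to (h g) ω₀) (≈-trans (∙-cong (elt-h g) eval-ω₀) (identityʳ g))
    where
    eval-ω₀ : eval ω₀ ≈ ε
    eval-ω₀ = ≈-trans (identityʳ _) (≈-trans (i.resp _ _ δ-1) i-id)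
      where
      δ-1 : s4Val (dih1 4 , 0F) ≈ₚ idₚ
      δ-1 x = addMod-identityˡ 4 x

  normalForm-injective : ∀ {g g′} → normalForm g ≡ normalForm g′ → g ≈ g′
  normalForm-injective {g} {g′} eq =
    ≈-trans (≈-sym (eval-normalForm g)) (≈-trans (reflexive (cong eval eq)) (eval-normalForm g′))

  -- Each letter acts on the normal form of the remaining word by being prepended unchanged, so
  -- different words have different values.
  normalForm-evalS : ∀ l → normalForm (evalS l) ≡ ((dih1 4 , 0F) , l)
  normalForm-evalD : ∀ l → normalForm (evalD l) ≡ fromΩ′ ((dih1 4 , 0F) , l)
  normalForm-evalS [] = proj₂ h.ε-homo ω₀
  normalForm-evalS (a ∷ l) = trans (act-∙ _ _ ω₀) (trans (cong (act _) (normalForm-evalD l))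
    (trans (act-j _ _) (trans (actD-fromΩ′ (rotation (suc a)) _) (cong (λ c → fromΩ′ (c , l))
      (trans (cong dihCode (trans (cong (dihMul n (rotation (suc a))) (dihVal-1 0F))
        (trans (dihMul-identityʳ n (rotation (suc a))) (sym (dihVal-1 (suc a))))))
        (dihCode-dihVal (dih1 4 , suc a)))))))
  normalForm-evalD [] = proj₂ h.ε-homo ω₀
  normalForm-evalD (k ∷ l) = trans (act-∙ _ _ ω₀) (trans (cong (act _) (normalForm-evalS l))
    (trans (act-i _ _) (cong (_, l) (s4Code-unique
      {cyc (suc k) ·ₛ s4Val (dih1 4 , 0F)} {dih1 4 , suc k} λ x →
      trans (cong (cyc (suc k) ⟨$⟩ʳ_) (addMod-identityˡ 4 x)) (sym (addMod-identityˡ 4 (cyc (suc k) ⟨$⟩ʳ x)))))))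

  -- Words for the powers of `j (rotation (suc a)) ∙ i (cyc 1F)`, an element of infinite order.
  power : Fin m₁ → ℕ → SFree
  power a zero = []
  power a (suc r) = a ∷ (0F ∷ power a r)

  power-injective : ∀ a r s → power a r ≡ power a s → r ≡ s
  power-injective a zero zero _ = refl
  power-injective a (suc r) (suc s) eq = cong suc (power-injective a r s (tail eq))
    where
    tail : ∀ {l l′} → a ∷ (0F ∷ l) ≡ a ∷ (0F ∷ l′) → l ≡ l′
    tail refl = refl

  powers-infinite : ∀ a (L : List Carrier) → ¬ (∀ r → Any (evalS (power a r) ≈_) L)
  powers-infinite a = injective⇒infinite setoid (λ r → evalS (power a r)) λ r s eq →
    power-injective a r s (cong proj₂ (trans (sym (normalForm-evalS (power a r)))
      (trans (normalForm-cong eq) (normalForm-evalS (power a s)))))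

-- The action of the amalgam on the tree

module ValenceThree
  (m₂ : ℕ)
  {G : Group 0ℓ 0ℓ} {i : S4 → Group.Carrier G} {j : Dih (4 * suc (suc m₂)) → Group.Carrier G}
  (amalgam : IsAmalgam (4 * suc (suc m₂)) G i j)
  {X : Graph} (base : Graph.V X)
  (paths : ∀ u w → Graph.Path X u w)
  (acyclic : ∀ v (p : Graph.Path X v v) → Graph.Reduced X p → Graph.length X p ≡ 0)
  (A : Action G X)
  (nonterminal : ∀ v → ¬ Graph.Terminal X v)
  (stabilizers : Action.FiniteStabilizers A)
  (quotient : Action.FiniteQuotient A) where

  private
    -- Here n is 4 (m₂ + 2), so `Fin m₁` is inhabited and D_n has a rotation outside D₄.
    m₁ n : ℕ
    m₁ = suc m₂
    n = 4 * suc m₁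

  module G = Group G
  open G using (Carrier; _≈_; _∙_; ε; _⁻¹)
  open Graph X using (V; E; o; rev; t; rev-invol; rev-nofix; Valence3)
  open Action A
  open IsAmalgam amalgam using (agree)
  open NormalForms m₁ amalgam
    using ([]; _∷_; evalS; evalD; _≟Ω_; normalForm; normalForm-injective; eval-normalForm;
           power; powers-infinite; i-id; i-flip; j-inv; module i; module j)
  open DihedralCosets (suc m₁) using (rotation)

  -- Finiteness of the quotient provides a section of the orbit map
  -- Fin k × G → Y, so equality in Y reduces to equality of normal forms.
  module _ {Y : Set} (act : Carrier → Y → Y) (resp : ∀ {g h} y → g ≈ h → act g y ≡ act h y)
           (L : List Y) (cover : ∀ y → Any (λ w → Σ Carrier λ g → act g w ≡ y) L) where

    ≟-from-cover : DecidableEquality Y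
    ≟-from-cover x y = map′ to from ((index x Fin.≟ index y) ×-dec (normalForm (shift x) ≟Ω normalForm (shift y)))
      where
      index : ∀ y → Fin (length L)
      index y = Any.index (cover y)
      shift : Y → Carrier
      shift y = proj₁ (lookup-index (cover y))
      shift-eq : ∀ y → act (shift y) (lookup L (index y)) ≡ y
      shift-eq y = proj₂ (lookup-index (cover y))
      to : index x ≡ index y × normalForm (shift x) ≡ normalForm (shift y) → x ≡ y
      to (same , eq) = trans (sym (shift-eq x)) (trans (resp _ (normalForm-injective eq))
        (trans (cong (λ z → act (shift y) (lookup L z)) same) (shift-eq y)))
      from : x ≡ y → index x ≡ index y × normalForm (shift x) ≡ normalForm (shift y)
      from refl = refl , refl

  opaque
    _≟V_ : DecidableEquality V
    _≟V_ = uncurry (≟-from-cover actV respV) (proj₁ quotient)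

    _≟E_ : DecidableEquality E
    _≟E_ = uncurry (≟-from-cover actE respE) (proj₂ quotient)

  open Geodesics X paths acyclic _≟E_
  open Equivariance A paths acyclic _≟E_

  S4-complete : ∀ σ → Any (λ τ → i σ ≈ i τ) (map s4Val s4Codes)
  S4-complete σ = Any.map (λ { refl → i.resp _ _ (λ x → sym (s4Val-s4Code σ x)) })
    (∈-map⁺ s4Val (∈-s4Codes (s4Code σ)))

  Dih-complete : ∀ x → Any (λ y → j x ≈ j y) (dihElements n)
  Dih-complete x = Any.map (λ { refl → G.refl }) (∈-dihElements n x)

  module S = FiniteGroup _≟V_ i _·ₛ_ flipₚ i.mult i-flip (map s4Val s4Codes) S4-complete
  module D = FiniteGroup _≟V_ j (dihMul n) (dihInv n) j.mult j-inv (dihElements n) Dih-complete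

  ι-actV : ∀ d v → actV (j (ι n d)) v ≡ actV (i (δ d)) v
  ι-actV d v = respV v (G.sym (agree d))

  ι-actE : ∀ d e → actE (j (ι n d)) e ≡ actE (i (δ d)) e
  ι-actE d e = respE e (G.sym (agree d))

  i-actE : ∀ {σ} τ τ′ e → σ ≈ₚ τ ·ₛ τ′ → actE (i σ) e ≡ actE (i τ) (actE (i τ′) e)
  i-actE τ τ′ e eq = trans (respE e (G.trans (i.resp _ _ eq) (i.mult τ τ′))) (compE _ _ e)

  -- Obstructions from the infinitude of the group

  power-induction : (P : Carrier → Set) → P ε → (∀ {g h} → P g → P h → P (g ∙ h)) →
    ∀ a → P (j (rotation (suc a))) → P (i (cyc 1F)) → ∀ r → P (evalS (power a r))
  power-induction P Pε P∙ a Pj Pi zero = Pε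
  power-induction P Pε P∙ a Pj Pi (suc r) = P∙ Pj (P∙ Pi (power-induction P Pε P∙ a Pj Pi r))

  -- Otherwise the finite stabilizer of `v` would contain infinitely many powers.
  S4-fixed⇒rotation-moves : ∀ {v} → (∀ σ → actV (i σ) v ≡ v) → ∀ a → actV (j (rotation (suc a))) v ≢ v
  S4-fixed⇒rotation-moves {v} S-fix a D-fix with L , covers ← stabilizers v =
    powers-infinite a L λ r → covers _
      (power-induction (λ g → actV g v ≡ v) (identV v)
        (λ {g} {h} pg ph → trans (compV g h v) (trans (cong (actV g) ph) pg)) a D-fix (S-fix _) r)

  Preserves : E → Carrier → Set
  Preserves e g = actE g e ≡ e ⊎ actE g e ≡ rev e

  Preserves-∙ : ∀ {e g h} → Preserves e g → Preserves e h → Preserves e (g ∙ h)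
  Preserves-∙ {e} {g} {h} pg (inj₁ ph) = [ (λ eq → inj₁ (trans step eq)) , (λ eq → inj₂ (trans step eq)) ]′ pg
    where
    step : actE (g ∙ h) e ≡ actE g e
    step = trans (compE g h e) (cong (actE g) ph)
  Preserves-∙ {e} {g} {h} pg (inj₂ ph) =
    [ (λ eq → inj₂ (trans step (cong rev eq)))
    , (λ eq → inj₁ (trans step (trans (cong rev eq) (rev-invol e)))) ]′ pg
    where
    step : actE (g ∙ h) e ≡ rev (actE g e)
    step = trans (compE g h e) (trans (cong (actE g) ph) (sym (rev-equiv g e)))

  -- An element fixing `e` lies in the stabilizer of `o e`; if `g` inverts `e`, then `c ∙ g` fixes
  -- it, so `g` lies in a translate of that stabilizer. Two finite lists would thus contain
  -- infinitely many powers.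
  no-invariant-edge : ∀ {e} c → actE c e ≡ rev e →
    (∀ σ → Preserves e (i σ)) → (∀ x → Preserves e (j x)) → ⊥
  no-invariant-edge {e} c inverts S-pres D-pres with L , covers ← stabilizers (o e) =
    powers-infinite 0F (L ++ map (c ⁻¹ ∙_) L) λ r → member _
      (power-induction (Preserves e) (inj₁ (identE e)) Preserves-∙ 0F (D-pres _) (S-pres _) r)
    where
    fixes-o : ∀ {g} → actE g e ≡ e → actV g (o e) ≡ o e
    fixes-o {g} eq = trans (sym (o-equiv g e)) (cong o eq)
    member : ∀ g → Preserves e g → Any (g ≈_) (L ++ map (c ⁻¹ ∙_) L)
    member g (inj₁ fix) = Any.++⁺ˡ (covers g (fixes-o fix))
    member g (inj₂ inv) = Any.++⁺ʳ L (Any.map⁺ (Any.map shift (covers (c ∙ g) (fixes-o cg-fix))))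
      where
      cg-fix : actE (c ∙ g) e ≡ e
      cg-fix = trans (compE c g e) (trans (cong (actE c) inv)
        (trans (sym (rev-equiv c e)) (trans (cong rev inverts) (rev-invol e))))
      shift : ∀ {y} → c ∙ g ≈ y → g ≈ c ⁻¹ ∙ y
      shift eq = G.trans (G.sym (G.identityˡ g)) (G.trans (G.∙-congʳ (G.sym (G.inverseˡ c)))
        (G.trans (G.assoc _ _ _) (G.∙-congˡ eq)))

  -- D₄ and the 3-cycle generate S₄.
  S4-fixes : ∀ {e} → (∀ d → actE (i (δ d)) e ≡ e) → actE (i (cyc 1F)) e ≡ e → ∀ σ → actE (i σ) e ≡ e
  S4-fixes {e} δ-fix s-fix σ with (d , k) , eq ← s4-code σ =
    trans (i-actE (δ d) (cyc k) e (λ x → sym (eq x))) (trans (cong (actE _) (cyc-fix k)) (δ-fix d))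
    where
    cyc-fix : ∀ k → actE (i (cyc k)) e ≡ e
    cyc-fix 0F = trans (respE e i-id) (identE e)
    cyc-fix 1F = s-fix
    cyc-fix 2F = trans (i-actE (cyc 1F) (cyc 1F) e cyc-square) (trans (cong (actE _) s-fix) s-fix)

  cyc-cube-actE : ∀ e → actE (i (cyc 1F)) (actE (i (cyc 2F)) e) ≡ e
  cyc-cube-actE e = trans (sym (i-actE {idₚ} (cyc 1F) (cyc 2F) e (λ x → sym (cyc-cube x))))
    (trans (respE e i-id) (identE e))

  -- A vertex fixed by S₄

  opaque
    -- Suppose S₄ inverts an edge `e`. If some element of D₄ inverts it, then D_n preserves `e` as
    -- well, which is excluded. If none does, D₄ and the 3-cycle fix `e`, hence so does all of S₄.
    S4-fixed-vertex : Σ V λ v → ∀ σ → actV (i σ) v ≡ v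
    S4-fixed-vertex with S.fixed-or-inverts base
    ... | inj₁ fixed = fixed
    ... | inj₂ (e , σ , inverts) = ⊥-elim (impossible (listAny? (dihElements 4) (∈-dihElements 4)
                                                          λ d → actE (i (δ d)) e ≟E rev e))
      where
      S-pres : ∀ τ → Preserves e (i τ)
      S-pres = S.inverted-edge-preserved σ inverts
      s²-fix : actE (i (cyc 1F)) e ≡ rev e → actE (i (cyc 2F)) e ≡ e
      s²-fix eq = trans (i-actE (cyc 1F) (cyc 1F) e cyc-square) (trans (cong (actE _) eq)
        (trans (sym (rev-equiv _ e)) (trans (cong rev eq) (rev-invol e))))
      -- An element of odd order cannot invert an edge: if it did, its square would fix `e`, and so
      -- would its cube, times the inverse of that square.
      s-fix : actE (i (cyc 1F)) e ≡ e
      s-fix with S-pres (cyc 1F)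
      ... | inj₁ fix = fix
      ... | inj₂ inv = trans (cong (actE _) (sym (s²-fix inv))) (cyc-cube-actE e)
      impossible : Dec (∃ λ d → actE (i (δ d)) e ≡ rev e) → ⊥
      impossible (yes (d , inv)) = no-invariant-edge (i σ) inverts S-pres
        (D.inverted-edge-preserved (ι n d) (trans (ι-actE d e) inv))
      impossible (no none) = rev-nofix e (trans (sym inverts) (S4-fixes δ-fix s-fix σ))
        where
        δ-fix : ∀ d → actE (i (δ d)) e ≡ e
        δ-fix d with S-pres (δ d)
        ... | inj₁ fix = fix
        ... | inj₂ inv = contradiction (d , inv) none

  -- The direction of the translates under D_n

  y₁ : Dih n
  y₁ = rotation 1F

  -- `e₁` is the direction in which D_n moves `v₀`. By `s-moves` its images under the powers of the
  -- 3-cycle are three edges, and these turn out to be all edges at `v₀`.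
  record Branching : Set where
    field
      v₀ : V
      S-fix : ∀ σ → actV (i σ) v₀ ≡ v₀
      e₁ : E
      p₁ : List E
      γ₁ : Geo v₀ (e₁ ∷ p₁) (actV (j y₁) v₀)
      s-moves : actE (i (cyc 1F)) e₁ ≢ e₁

  -- As part of S₄ the group D₄ fixes `v`; as part of D_n it then fixes the direction in which D_n
  -- moves `v`.
  D4-fixes : ∀ {v e p} → (∀ σ → actV (i σ) v ≡ v) → Geo v (e ∷ p) (actV (j y₁) v) → ∀ d → actE (i (δ d)) e ≡ e
  D4-fixes {v} {e} S-fix γ d = trans (sym (ι-actE d e))
    (D.stabilizer-fixes-direction y₁ (ι n d) (trans (ι-actV d v) (S-fix (δ d))) γ)

  -- If the 3-cycle fixes `e`, all of S₄ does, so `t e` is again fixed by S₄ and is displaced less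
  -- by `y₁`. Should `y₁` invert `e`, both factors would preserve this edge.
  branching-within : ∀ N v → (∀ σ → actV (i σ) v ≡ v) → dist (actV (j y₁) v) v ≤ N → Branching
  branching-within N v S-fix ≤N with first (λ eq → S4-fixed⇒rotation-moves S-fix 0F (sym eq))
  ... | e , p , γ with actE (i (cyc 1F)) e ≟E e
  ... | no moves = record { S-fix = S-fix ; γ₁ = γ ; s-moves = moves }
  ... | yes s-fix = closer N (subst (_≤ N) (dist-sym-Geo (e ∷ p) γ) ≤N) (D.shrink y₁ γ)
    where
    e-fix : ∀ σ → actE (i σ) e ≡ e
    e-fix = S4-fixes (D4-fixes S-fix γ) s-fix
    closer : ∀ N → suc (length p) ≤ N →
             actE (j y₁) e ≡ rev e ⊎ dist (actV (j y₁) (t e)) (t e) < length p → Branching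
    closer N _ (inj₁ inverts) = ⊥-elim (no-invariant-edge (j y₁) inverts (λ σ → inj₁ (e-fix σ))
                                          (D.inverted-edge-preserved y₁ inverts))
    closer (suc N) (s≤s p≤N) (inj₂ lt) =
      branching-within N (t e) (λ σ → fixes-t (e-fix σ)) (≤-trans (ℕ.<⇒≤ lt) p≤N)

  opaque
    branching : Branching
    branching = branching-within _ (proj₁ S4-fixed-vertex) (proj₂ S4-fixed-vertex) ≤-refl

  open Branching branching

  edge : Fin 3 → E
  edge k = actE (i (cyc k)) e₁

  edge-0 : edge 0F ≡ e₁
  edge-0 = trans (respE e₁ i-id) (identE e₁)

  cyc-2-moves : edge 2F ≢ e₁
  cyc-2-moves eq = s-moves (trans (cong (actE _) (sym eq)) (cyc-cube-actE e₁))

  edge-moved : ∀ k → edge (suc k) ≢ e₁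
  edge-moved 0F = s-moves
  edge-moved 1F = cyc-2-moves

  edge-1≢2 : edge 1F ≢ edge 2F
  edge-1≢2 eq = s-moves (sym (actE-injective (i (cyc 1F)) (trans eq (i-actE (cyc 1F) (cyc 1F) e₁ cyc-square))))

  o-e₁ : o e₁ ≡ v₀
  o-e₁ = proj₁ (proj₁ γ₁)

  o-edge : ∀ k → o (edge k) ≡ v₀
  o-edge k = trans (o-equiv _ e₁) (trans (cong (actV _) o-e₁) (S-fix (cyc k)))

  opaque
    S4-edge : ∀ c → ∃ λ k → actE (i (s4Val c)) e₁ ≡ edge k
    S4-edge c with (d , k) , eq ← s4Val-left-coset c =
      k , trans (i-actE (cyc k) (δ d) e₁ eq) (cong (actE _) (D4-fixes S-fix γ₁ d))

    first-rotation : ∀ a → Σ (List E) λ p → Geo v₀ (e₁ ∷ p) (actV (j (rotation (suc a))) v₀)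
    first-rotation a with first (λ eq → S4-fixed⇒rotation-moves S-fix a (sym eq))
    ... | f , p , γ = p , subst (λ h → Geo v₀ (h ∷ p) _) (sym (D.same-direction y₁ (rotation (suc a)) γ₁ γ)) γ

  -- Geodesics from v₀ to its orbit

  Leads : (E → Set) → List E → Set
  Leads P [] = ⊤
  Leads P (f ∷ _) = P f

  Apart-map : ∀ g {e r} q → Apart (e ∷ []) q → Apart (actE g e ∷ r) (map (actE g) q)
  Apart-map g [] _ = tt
  Apart-map g (f ∷ q) ne = λ eq → ne (actE-injective g eq)

  -- The geodesics between consecutive translates of v₀ along a normal form
  -- concatenate to a reduced path, because they meet at translates of v₀
  -- where an element of S₄ outside D₄ turns e₁ into a different edge.
  geoS : ∀ l → Σ (List E) λ q → Geo v₀ q (actV (evalS l) v₀) × Leads (_≡ e₁) q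
  geoD : ∀ l → Σ (List E) λ q → Geo v₀ q (actV (evalD l) v₀) × Apart (e₁ ∷ []) q
  geoS [] = [] , (sym (identV v₀) , tt) , tt
  geoS (a ∷ l) = e₁ ∷ p ++ map (actE g) q , subst₂ (Geo v₀) path (sym (compV g (evalD l) v₀)) joined , refl
    where
    g = j (rotation (suc a))
    p = proj₁ (first-rotation a)
    q = proj₁ (geoD l)
    back = D.return (rotation (suc a)) (proj₂ (first-rotation a))
    joined : Geo v₀ (revOnto (actE g e₁ ∷ proj₁ back) (map (actE g) q)) (actV g (actV (evalD l) v₀))
    joined = through _ _ (proj₂ back) (Geo-act g (proj₁ (proj₂ (geoD l)))) (Apart-map g q (proj₂ (proj₂ (geoD l))))
    path : revOnto (actE g e₁ ∷ proj₁ back) (map (actE g) q) ≡ e₁ ∷ p ++ map (actE g) q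
    path = trans (revOnto-++ (actE g e₁ ∷ proj₁ back) [] (map (actE g) q)) (cong (_++ map (actE g) q)
      (Geo-unique _ _ (Geo-sym _ (proj₂ back)) (proj₂ (first-rotation a))))
  geoD [] = [] , (sym (identV v₀) , tt) , tt
  geoD (k ∷ l) = map (actE g) (proj₁ (geoS l)) ,
    subst₂ (λ u w → Geo u (map (actE g) (proj₁ (geoS l))) w) (S-fix (cyc (suc k))) (sym (compV g (evalS l) v₀))
      (Geo-act g (proj₁ (proj₂ (geoS l)))) ,
    apart (proj₁ (geoS l)) (proj₂ (proj₂ (geoS l)))
    where
    g = i (cyc (suc k))
    apart : ∀ q → Leads (_≡ e₁) q → Apart (e₁ ∷ []) (map (actE g) q)
    apart [] _ = tt
    apart (f ∷ q) refl = λ eq → edge-moved k (sym eq)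

  -- The head of the normal form lies in S₄: it fixes `v₀` and carries the first edge `e₁` to one of
  -- the three edges.
  geo-orbit : ∀ g → Σ (List E) λ q → Geo v₀ q (actV g v₀) × Leads (λ f → ∃ λ k → f ≡ edge k) q
  geo-orbit g = map (actE h) (proj₁ (geoS l)) ,
    subst₂ (λ u w → Geo u (map (actE h) (proj₁ (geoS l))) w) (S-fix (s4Val c))
      (trans (sym (compV h (evalS l) v₀)) (respV v₀ (eval-normalForm g)))
      (Geo-act h (proj₁ (proj₂ (geoS l)))) ,
    leads (proj₁ (geoS l)) (proj₂ (proj₂ (geoS l)))
    where
    c = proj₁ (normalForm g)
    l = proj₂ (normalForm g)
    h = i (s4Val c)
    leads : ∀ q → Leads (_≡ e₁) q → Leads (λ f → ∃ λ k → f ≡ edge k) (map (actE h) q)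
    leads [] _ = tt
    leads (f ∷ q) refl = S4-edge c

  -- Exclusion of a fourth edge

  module _ {f : E} (o-f : o f ≡ v₀) (f-other : ∀ k → f ≢ edge k) where

    -- The vertices beyond `f` at distance `r` from `t f`. Their geodesics point towards `v₀`, so a
    -- step further out prepends an edge.
    Branch : ℕ → Set
    Branch r = Σ V λ x → Σ (List E) λ p → Geo x (p ++ rev f ∷ []) v₀ × length p ≡ r

    -- Without an extension, the edge towards `v₀` would be the only edge at `x`, making `x`
    -- terminal. Since `nonterminal` is a negation, no edge is exhibited, hence the double negation.
    branch-extends : ∀ {r} → Branch r → ¬ ¬ Branch (suc r)
    branch-extends {r} (x , p , γ , len) none = dead-end (p ++ rev f ∷ []) refl γ
      where
      -- The list is generalized to `q` so that its first edge can be matched.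
      dead-end : ∀ q → q ≡ p ++ rev f ∷ [] → Geo x q v₀ → ⊥
      dead-end [] eq _ = ℕ.0≢1+n (trans (cong length eq) (trans (length-++ p) (ℕ.+-comm (length p) 1)))
      dead-end (h ∷ q) eq ((o-h , c) , red) =
        nonterminal x (h , o-h , λ e o-e → decidable-stable (e ≟E h) λ e≢h →
          none (t e , rev e ∷ p ,
            subst (λ q → Geo (t e) (rev e ∷ q) v₀) eq
              ((refl , trans o-h (sym (trans (t-rev e) o-e)) , c) ,
               (λ eq′ → e≢h (trans (sym (rev-invol e)) eq′)) , red) ,
            cong suc len))

    long-branch : ∀ r → ¬ ¬ Branch r
    long-branch zero none = none
      (t f , [] , subst (Geo (t f) (rev f ∷ [])) (trans (t-rev f) o-f) (Geo-edge (rev f)) , refl)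
    long-branch (suc r) none = long-branch r λ b → branch-extends b none

    -- Write `x` as a translate by `g` of a representative `w`. The geodesic from `x` to `actV g v₀`
    -- passes through `v₀`, arriving by `rev f` and leaving by one of the three edges, so it is
    -- longer than `p`; but its length is that from `w` to `v₀`.
    branch-bounded : Σ ℕ λ M → ¬ Branch M
    branch-bounded = M , λ (x , p , γ , len) → bound x p γ len
      where
      L = proj₁ (proj₁ quotient)
      M : ℕ
      -- The sum bounds each of the finitely many distances.
      M = sum (map (λ w → dist w v₀) L)
      bound : ∀ x p → Geo x (p ++ rev f ∷ []) v₀ → length p ≡ M → ⊥
      bound x p γ len = ℕ.<⇒≱ (≤-reflexive (cong suc (sym len)))
        (Any-≤-sum (λ w → dist w v₀) (λ (g , eq) → short g eq) (proj₂ (proj₁ quotient) x))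
        where
        out : List E
        out = revOnto (p ++ rev f ∷ []) []
        out≡ : out ≡ f ∷ revOnto p []
        out≡ = trans (revOnto-snoc p (rev f) []) (cong (_∷ revOnto p []) (rev-invol f))
        out-length : length out ≡ suc (length p)
        out-length = trans (length-revOnto (p ++ rev f ∷ []) []) (trans (ℕ.+-identityʳ _)
          (trans (length-++ p) (ℕ.+-comm (length p) 1)))
        short : ∀ g {w} → actV g w ≡ x → suc (length p) ≤ dist w v₀
        short g {w} refl = ≤-trans (m≤m+n (suc (length p)) (length q)) (≤-reflexive (trans
          (cong (_+ length q) (sym out-length)) (trans (sym (length-revOnto out q)) (trans
          (cong length (Geo-unique _ _ (through out q (Geo-sym _ γ) q-geo apart)
                                       (Geo-act g (proj₂ (geodesic w v₀)))))
          (length-map (actE g) (proj₁ (geodesic w v₀)))))))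
          where
          q = proj₁ (geo-orbit g)
          q-geo : Geo v₀ q (actV g v₀)
          q-geo = proj₁ (proj₂ (geo-orbit g))
          apart : Apart out q
          apart = subst (λ r → Apart r q) (sym out≡) (apart′ q (proj₂ (proj₂ (geo-orbit g))))
            where
            apart′ : ∀ q → Leads (λ f → ∃ λ k → f ≡ edge k) q → Apart (f ∷ revOnto p []) q
            apart′ [] _ = tt
            apart′ (_ ∷ _) (k , eq) = λ f≡ → f-other k (trans f≡ eq)

  v₀-valence : Valence3 v₀
  v₀-valence = edge 0F , edge 1F , edge 2F , o-edge 0F , o-edge 1F , o-edge 2F ,
    (λ eq → s-moves (trans (sym eq) edge-0)) , (λ eq → cyc-2-moves (trans (sym eq) edge-0)) , edge-1≢2 , all
    where
    all : ∀ e → o e ≡ v₀ → e ≡ edge 0F ⊎ e ≡ edge 1F ⊎ e ≡ edge 2F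
    all e o-e with e ≟E edge 0F | e ≟E edge 1F | e ≟E edge 2F
    ... | yes eq | _ | _ = inj₁ eq
    ... | no _ | yes eq | _ = inj₂ (inj₁ eq)
    ... | no _ | no _ | yes eq = inj₂ (inj₂ eq)
    ... | no ne₀ | no ne₁ | no ne₂ = ⊥-elim (long-branch o-e other _ (proj₂ (branch-bounded o-e other)))
      where
      other : ∀ k → e ≢ edge k
      other 0F = ne₀
      other 1F = ne₁
      other 2F = ne₂

-- Reduction to n = 4 (m₂ + 2)

theorem7p6 : (n : ℕ) .{{_ : NonZero n}} → 4 ∣ n → 8 ≤ n →
    (G : Group 0ℓ 0ℓ) (i : S4 → Group.Carrier G) (j : Dih n → Group.Carrier G) →
    IsAmalgam n G i j →
    (X : Graph) → Graph.IsTree X →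
    (A : Action G X) →
    (∀ v → ¬ Graph.Terminal X v) →
    Action.FiniteStabilizers A →
    Action.FiniteQuotient A →
    Σ (Graph.V X) λ v →
    (∀ σ → Action.actV A (i σ) v ≡ v) × Graph.Valence3 X v
theorem7p6 n (divides m n≡m*4) 8≤n G i j amalgam X (base , paths , acyclic) A nonterminal stabilizers quotient
  with m | trans n≡m*4 (ℕ.*-comm m 4)
... | 0 | refl = contradiction 8≤n λ ()
... | 1 | refl = contradiction 8≤n (ℕ.<⇒≱ (toWitness {a? = 4 ℕ.<? 8} tt))
... | suc (suc m₂) | refl = v₀ , S-fix , v₀-valence
  where
  open ValenceThree m₂ amalgam base paths acyclic A nonterminal stabilizers quotient
  open Branching branching
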